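{- The class of functions $f:\mathbb{N}\to\mathbb{N}$ that can be computed in polynomial time by an $\mathrm{ASRAM}[+,\dot{ - },\times,\div]$ is strictly larger than the class of functions that can be computed in polynomial time by an $\mathrm{ARAM}[+,\dot{ - },\times,\div]$.
   Context: A $\mathrm{RAM}[\mathit{op}]$ is a unit-cost random access machine with registers $R[0],R[1],\dots$ holding nonnegative integers, with direct and indirect addressing, conditional jumps, an equality comparator, and the operations in the set $\mathit{op}$, each executed in one unit of time. On input $\mathit{inp}$ (a nonnegative integer, or a fixed number of them) the input is placed in $R[0]$, all other registers are $0$, and the output is the value of $R[0]$ at termination. Here $a\dot{ - }b=\max(a-b,0)$ and $\div$ is integer division (quotient rounded down). ARAM: an $\mathrm{ARAM}[\mathit{op}]$ is given by a $\mathrm{RAM}[\mathit{op}]$ program $r$ computing a two-argument function $\rho(\mathit{inp},A)$; it computes $\rho_A$ if for every $\mathit{inp}$, $\rho(\mathit{inp},A)=\rho_A(\mathit{inp})$ for all but finitely many $A$. Its running time on $\mathit{inp}$ is the supremum over all $A$ of the running time of $r$ on $(\mathit{inp},A)$. ALS set: a nonempty set $\mathbf{S}$ of infinite integer sequences such that for every $i$ and every $\{A_k\}\in\mathbf{S}$ there is $\{B_k\}\in\mathbf{S}$ with $B_i=A_i+1$ and $B_j=A_j$ for all $j<i$. ASRAM: an $\mathrm{ASRAM}[\mathit{op}]$ is a $\mathrm{RAM}[\mathit{op}]$ program that may additionally call a pseudofunction $\mathit{ALN}()$ returning an integer. It computes $f$ if for each $\mathit{inp}$ there is an ALS set $\mathbf{S}$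 such that for every $\{A_i\}\in\mathbf{S}$, replacing the $i$-th invocation of $\mathit{ALN}()$ by the constant $A_i$ yields a RAM computing $f(\mathit{inp})$ on input $\mathit{inp}$. Its running time on $\mathit{inp}$ is the worst case over all choices of the sequence $\{A_i\}$ of the running time of the resulting RAM. Polynomial time means running time bounded by a polynomial in the bit-length of the input. -}

module Defs where

open import Level using (0ℓ; suc)
open import Data.Bool using (if_then_else_)
open import Data.List using (List; []; _∷_; head; drop)
open import Data.List.Membership.Propositional using (_∉_)
open import Data.Maybe using (Maybe; just; nothing; fromMaybe)
import Data.Maybe as Maybe
open import Data.Nat using (ℕ; zero; _+_; _∸_; _*_; _/_; _≤_; _<_; _≡ᵇ_)
open import Data.Nat.Logarithm using (⌈log₂_⌉)
open import Data.Product using (_×_; _,_; ∃; ∃₂)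
open import Relation.Binary.PropositionalEquality using (_≡_)
open import Relation.Unary using (Pred)

nth : {X : Set} → List X → ℕ → Maybe X
nth xs n = head (drop n xs)

-- step ⊢ s ⇓⟨ t ⟩ s′ : the deterministic system started in s halts in s′
-- after exactly t steps; step returns nothing on halted states.
data _⊢_⇓⟨_⟩_ {S : Set} (step : S → Maybe S) : S → ℕ → S → Set where
  stop : ∀ {s} → step s ≡ nothing → step ⊢ s ⇓⟨ 0 ⟩ s
  next : ∀ {s s′ s″ t} → step s ≡ just s′ →
         step ⊢ s′ ⇓⟨ t ⟩ s″ → step ⊢ s ⇓⟨ ℕ.suc t ⟩ s″

Registers : Set
Registers = ℕ → ℕ

_[_≔_] : Registers → ℕ → ℕ → Registers
(R [ k ≔ v ]) j = if j ≡ᵇ k then v else R j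

-- The inputs x₀, …, xₖ₋₁ are placed in R[0], …, R[k-1].
initial : List ℕ → Registers
initial xs k = fromMaybe 0 (nth xs k)

-- R[k] and R[R[k]].
data Location : Set where
  direct indirect : ℕ → Location

address : Registers → Location → ℕ
address R (direct k)   = k
address R (indirect k) = R k

data Operand : Set where
  const : ℕ → Operand
  load  : Location → Operand

value : Registers → Operand → ℕ
value R (const c) = c
value R (load l)  = R (address R l)

record State : Set where
  constructor ⟨_,_⟩
  field
    pc   : ℕ
    regs : Registers

open State public

output : State → ℕ
output σ = regs σ 0

bitLength : ℕ → ℕ
bitLength n = ⌈log₂ ℕ.suc n ⌉

-- Coefficients in increasing degree.  For upper bounds, natural coefficients
-- lose no generality.
Polynomial : Set
Polynomial = List ℕ

eval : Polynomial → ℕ → ℕ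
eval []       n = 0
eval (c ∷ cs) n = c + n * eval cs n

ForAllButFinitelyMany : Pred ℕ 0ℓ → Set
ForAllButFinitelyMany P = ∃ λ exceptions → ∀ A → A ∉ exceptions → P A

record IsALS (𝐒 : Pred (ℕ → ℕ) 0ℓ) : Set where
  field
    nonempty  : ∃ λ A → 𝐒 A
    increment : ∀ i A → 𝐒 A →
                ∃ λ B → 𝐒 B × B i ≡ ℕ.suc (A i) × (∀ j → j < i → B j ≡ A j)

module Machine (Op : Set) (⟦_⟧ : Op → ℕ → ℕ → ℕ) where

  data Instr : Set where
    assign : Location → Operand → Instr
    apply  : Op → Location → Operand → Operand → Instr
    jumpEq : Operand → Operand → ℕ → Instr

  exec : Instr → State → State
  exec (assign l a)   ⟨ pc , R ⟩ = ⟨ ℕ.suc pc , R [ address R l ≔ value R a ] ⟩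
  exec (apply o l a b) ⟨ pc , R ⟩ =
    ⟨ ℕ.suc pc , R [ address R l ≔ ⟦ o ⟧ (value R a) (value R b) ] ⟩
  exec (jumpEq a b t) ⟨ pc , R ⟩ =
    ⟨ (if value R a ≡ᵇ value R b then t else ℕ.suc pc) , R ⟩

  -- A program terminates when the program counter leaves it.
  RAM : Set
  RAM = List Instr

  ramStep : RAM → State → Maybe State
  ramStep r σ = Maybe.map (λ ins → exec ins σ) (nth r (pc σ))

  RAMHalts : RAM → List ℕ → (time out : ℕ) → Set
  RAMHalts r inputs t v =
    ∃ λ σ → ramStep r ⊢ ⟨ 0 , initial inputs ⟩ ⇓⟨ t ⟩ σ × output σ ≡ v

  RAMComputes₂ : RAM → (ℕ → ℕ → ℕ) → Set
  RAMComputes₂ r ρ = ∀ x y → ∃ λ t → RAMHalts r (x ∷ y ∷ []) t (ρ x y)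

  ARAMComputes : RAM → (ℕ → ℕ) → Set
  ARAMComputes r f =
    ∃ λ ρ → RAMComputes₂ r ρ ×
      (∀ inp → ForAllButFinitelyMany λ A → ρ inp A ≡ f inp)

  -- A supremum is at most b iff every member is.
  ARAMTime≤ : RAM → (inp b : ℕ) → Set
  ARAMTime≤ r inp b =
    ∀ A → ∃₂ λ t v → RAMHalts r (inp ∷ A ∷ []) t v × t ≤ b

  PolyTimeARAM : Pred (ℕ → ℕ) 0ℓ
  PolyTimeARAM f = ∃ λ r → ARAMComputes r f ×
    (∃ λ p → ∀ inp → ARAMTime≤ r inp (eval p (bitLength inp)))

  data ASInstr : Set where
    ram     : Instr → ASInstr
    callALN : Location → ASInstr

  ASRAM : Set
  ASRAM = List ASInstr

  -- The second component counts the invocations of ALN() made so far.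
  ASState : Set
  ASState = State × ℕ

  asExec : (ℕ → ℕ) → ASInstr → ASState → ASState
  asExec A (ram ins)   (σ , i) = exec ins σ , i
  asExec A (callALN l) (σ , i) = exec (assign l (const (A i))) σ , ℕ.suc i

  asStep : (ℕ → ℕ) → ASRAM → ASState → Maybe ASState
  asStep A r s@(σ , _) = Maybe.map (λ ins → asExec A ins s) (nth r (pc σ))

  ASRAMHalts : (ℕ → ℕ) → ASRAM → ℕ → (time out : ℕ) → Set
  ASRAMHalts A r inp t v =
    ∃₂ λ σ i → asStep A r ⊢ (⟨ 0 , initial (inp ∷ []) ⟩ , 0) ⇓⟨ t ⟩ (σ , i)
             × output σ ≡ v

  ASRAMComputes : ASRAM → (ℕ → ℕ) → Set (suc 0ℓ)
  ASRAMComputes r f = ∀ inp → ∃ λ 𝐒 → IsALS 𝐒 ×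
    (∀ A → 𝐒 A → ∃ λ t → ASRAMHalts A r inp t (f inp))

  -- The worst case ranges over all sequences, not only those of an ALS set.
  ASRAMTime≤ : ASRAM → (inp b : ℕ) → Set
  ASRAMTime≤ r inp b = ∀ A → ∃₂ λ t v → ASRAMHalts A r inp t v × t ≤ b

  PolyTimeASRAM : Pred (ℕ → ℕ) (suc 0ℓ)
  PolyTimeASRAM f = ∃ λ r → ASRAMComputes r f ×
    (∃ λ p → ∀ inp → ASRAMTime≤ r inp (eval p (bitLength inp)))

data ArithOp : Set where
  add monus mul div : ArithOp

-- Division by 0 is given the value 0.  Polynomial-time classes do not depend
-- on this choice, as a program can test the divisor first.
_÷_ : ℕ → ℕ → ℕ
a ÷ zero      = 0
a ÷ (ℕ.suc b) = a / ℕ.suc b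

arith : ArithOp → ℕ → ℕ → ℕ
arith add   = _+_
arith monus = _∸_
arith mul   = _*_
arith div   = _÷_

open Machine ArithOp arith public
  using () renaming (PolyTimeARAM to PolyTimeARAM[+,∸,×,÷]; PolyTimeASRAM to PolyTimeASRAM[+,∸,×,÷])

{-# OPTIONS --safe #-}

-- The separating function is n ↦ 2^2^2^(bit length of n).
--
-- ASRAM: if P = a^E and X + X^E < a, then P mod (a - X) = X^E, so one large
-- number a turns raising to the power E into a single division.  Applying this
-- twice to a much smaller a′ gives a′^(E²), which serves in the same way for
-- numbers still smaller than a′.  After k large numbers the exponent is 2^2^k.
--
-- ARAM: as long as A is large, every register content v after t steps satisfies
-- d v = Σ cᵢ Aⁱ with at most 2^(t+1) integer digits, where d and all ∣cᵢ∣ are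
-- at most 2^2^poly(t, bit length).  Division preserves this by pseudo-division
-- of the digit polynomials: it approximates the quotient up to a constant, which
-- is absorbed by the lowest digit.  An output that does not depend on A is
-- therefore at most the digit bound.
module Submission where

open import Defs
open import Data.Bool using (true; false)
open import Data.Empty using (⊥-elim)
import Data.Integer as ℤ
open ℤ using (ℤ; -[1+_]; 0ℤ) renaming (+_ to pos; ∣_∣ to abs)
import Data.Integer.Properties as ℤ
import Data.Integer.Tactic.RingSolver as ℤ-Ring
open import Data.List using ([]; _∷_; map; length)
open import Data.List.Membership.Propositional using () renaming (_∈_ to _∈ᴸ_)
open import Data.List.Relation.Unary.Any using (here; there)
open import Data.Maybe using (Maybe; just; nothing)
import Data.Maybe as Maybe
open import Data.Maybe.Properties using (just-injective)
open import Data.Maybe.Relation.Binary.Pointwise using (Pointwise; just; nothing)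
open import Data.Nat using (ℕ; zero; suc; pred; _+_; _*_; _∸_; _^_; _/_; _%_; ⌊_/2⌋; _≡ᵇ_; _≤_; _<_; z≤n; s≤s; s≤s⁻¹; z<s; _≤?_; NonZero; >-nonZero; ≢-nonZero⁻¹)
open import Data.Nat.DivMod using (m≡m%n+[m/n]*n; m%n<n; m%n≡m∸m/n*n; [m+kn]%n≡m%n; m<n⇒m%n≡m; m/n≡1+[m∸n]/n)
open import Data.Nat.ListAction using (sum)
open import Data.Nat.Logarithm using (⌈log₂_⌉; ⌈log₂⌈n/2⌉⌉≡⌈log₂n⌉∸1; ⌈log₂⌉-mono-≤; ⌈log₂2^n⌉≡n)
open import Data.Nat.Properties
import Data.Nat.Tactic.RingSolver as ℕ-Ring
open import Data.Product as Product using (_×_; _,_; ∃; ∃₂; proj₁; proj₂; uncurry)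
open import Data.Sum using (inj₁; inj₂)
open import Data.Unit using (tt)
open import Function using (_∘_)
open import Relation.Binary.PropositionalEquality
open import Relation.Nullary using (¬_; yes; no; contradiction)
open import Relation.Unary using (_⊆_; _∈_; _∉_)

open Machine ArithOp arith

-- Expansions in powers of A

module _ (A : ℕ) where

  -- x = Σ_{i<n} cᵢ Aⁱ with all ∣cᵢ∣ ≤ H.
  Expansion : (n H : ℕ) → ℤ → Set
  Expansion zero    H x = x ≡ 0ℤ
  Expansion (suc n) H x = ∃₂ λ c y → abs c ≤ H × Expansion n H y × x ≡ c ℤ.+ pos A ℤ.* y

  expand-0 : ∀ n H → Expansion n H 0ℤ
  expand-0 zero    H = refl
  expand-0 (suc n) H = 0ℤ , 0ℤ , z≤n , expand-0 n H , sym (trans (ℤ.+-identityˡ _) (ℤ.*-zeroʳ (pos A)))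

  expand-mono : ∀ {m n H K x} → m ≤ n → H ≤ K → Expansion m H x → Expansion n K x
  expand-mono {n = n} {K = K} z≤n H≤K refl = expand-0 n K
  expand-mono (s≤s m≤n) H≤K (c , y , c≤H , ey , eq) =
    c , y , ≤-trans c≤H H≤K , expand-mono m≤n H≤K ey , eq

  expand-const : ∀ {n H c} → 1 ≤ n → abs c ≤ H → Expansion n H c
  expand-const {H = H} {c} 1≤n c≤H = expand-mono 1≤n ≤-refl
    (c , 0ℤ , c≤H , refl , sym (trans (cong (λ u → c ℤ.+ u) (ℤ.*-zeroʳ (pos A))) (ℤ.+-identityʳ c)))

  expand-shift : ∀ {n H x} → Expansion n H x → Expansion (suc n) H (pos A ℤ.* x)
  expand-shift ex = 0ℤ , _ , z≤n , ex , sym (ℤ.+-identityˡ _)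

  expand-+ : ∀ {n H K x y} → Expansion n H x → Expansion n K y → Expansion n (H + K) (x ℤ.+ y)
  expand-+ {zero} refl refl = refl
  expand-+ {suc n} (c , x , c≤H , ex , refl) (d , y , d≤K , ey , refl) =
    c ℤ.+ d , x ℤ.+ y , ≤-trans (ℤ.∣i+j∣≤∣i∣+∣j∣ c d) (+-mono-≤ c≤H d≤K) , expand-+ ex ey ,
    regroup c d (pos A) x y
    where
    regroup : ∀ c d a x y → (c ℤ.+ a ℤ.* x) ℤ.+ (d ℤ.+ a ℤ.* y) ≡ (c ℤ.+ d) ℤ.+ a ℤ.* (x ℤ.+ y)
    regroup = ℤ-Ring.solve-∀

  expand-scale : ∀ {n H K x} b → abs b ≤ K → Expansion n H x → Expansion n (K * H) (b ℤ.* x)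
  expand-scale {zero} b b≤K refl = ℤ.*-zeroʳ b
  expand-scale {suc n} {H} {K} b b≤K (c , x , c≤H , ex , refl) =
    b ℤ.* c , b ℤ.* x , ≤-trans (≤-reflexive (ℤ.abs-* b c)) (*-mono-≤ b≤K c≤H) ,
    expand-scale b b≤K ex , regroup b c (pos A) x
    where
    regroup : ∀ b c a x → b ℤ.* (c ℤ.+ a ℤ.* x) ≡ b ℤ.* c ℤ.+ a ℤ.* (b ℤ.* x)
    regroup = ℤ-Ring.solve-∀

  expand-neg : ∀ {n H x} → Expansion n H x → Expansion n H (ℤ.- x)
  expand-neg {n} {H} {x} ex = subst₂ (Expansion n) (*-identityˡ H) (ℤ.-1*i≡-i x)
    (expand-scale ℤ.-1ℤ ≤-refl ex)

  expand-minus : ∀ {n H K x y} → Expansion n H x → Expansion n K y → Expansion n (H + K) (x ℤ.- y)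
  expand-minus ex ey = expand-+ ex (expand-neg ey)

  expand-∣∣ : ∀ {n H x} → Expansion n H x → Expansion n H (pos (abs x))
  expand-∣∣ {x = pos _}      ex = ex
  expand-∣∣ {x = -[1+ _ ]} ex = expand-neg ex

  expand-* : ∀ {m n H K x y} → Expansion m H x → Expansion n K y →
             Expansion (m + n) (m * (H * K)) (x ℤ.* y)
  expand-* {zero} {n} refl ey = expand-0 n 0
  expand-* {suc m} {n} {H} {K} {y = y} (c , x , c≤H , ex , refl) ey =
    subst (Expansion (suc m + n) _) (sym (regroup c (pos A) x y))
      (expand-+ (expand-mono (m≤n+m n (suc m)) ≤-refl (expand-scale c c≤H ey))
                (expand-shift (expand-* ex ey)))
    where
    regroup : ∀ c a x y → (c ℤ.+ a ℤ.* x) ℤ.* y ≡ c ℤ.* y ℤ.+ a ℤ.* (x ℤ.* y)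
    regroup = ℤ-Ring.solve-∀

  expand-top : ∀ n {H x} → Expansion (suc n) H x →
               ∃₂ λ c y → abs c ≤ H × Expansion n H y × x ≡ c ℤ.* pos (A ^ n) ℤ.+ y
  expand-top zero (c , _ , c≤H , refl , refl) = c , 0ℤ , c≤H , refl , drop-0 c (pos A)
    where
    drop-0 : ∀ c a → c ℤ.+ a ℤ.* 0ℤ ≡ c ℤ.* ℤ.1ℤ ℤ.+ 0ℤ
    drop-0 = ℤ-Ring.solve-∀
  expand-top (suc n) (d , _ , d≤H , ex , refl) with expand-top n ex
  ... | c , y , c≤H , ey , refl =
    c , d ℤ.+ pos A ℤ.* y , c≤H , (d , y , d≤H , ey , refl) ,
    trans (regroup d (pos A) c (pos (A ^ n)) y)
          (cong (λ p → c ℤ.* p ℤ.+ (d ℤ.+ pos A ℤ.* y)) (sym (ℤ.pos-* A (A ^ n))))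
    where
    regroup : ∀ d a c p y → d ℤ.+ a ℤ.* (c ℤ.* p ℤ.+ y) ≡ c ℤ.* (a ℤ.* p) ℤ.+ (d ℤ.+ a ℤ.* y)
    regroup = ℤ-Ring.solve-∀

  -- Since ∣c∣ < A, one has ∣c + A y∣ < A (1 + ∣y∣), and inductively 1 + ∣y∣ is at most the next
  -- lower power of A.
  expand-< : ∀ {n H x} → H < A → Expansion n H x → abs x < A ^ n
  expand-< {zero}  H<A refl = ≤-refl
  expand-< {suc n} {H} H<A (c , y , c≤H , ey , refl) = begin-strict
    abs (c ℤ.+ pos A ℤ.* y)       ≤⟨ ℤ.∣i+j∣≤∣i∣+∣j∣ c _ ⟩
    abs c + abs (pos A ℤ.* y)     ≡⟨ cong (abs c +_) (ℤ.abs-* (pos A) y) ⟩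
    abs c + A * abs y         <⟨ +-monoˡ-< (A * abs y) (≤-<-trans c≤H H<A) ⟩
    A + A * abs y             ≡⟨ *-suc A (abs y) ⟨
    A * suc (abs y)             ≤⟨ *-monoʳ-≤ A (expand-< H<A ey) ⟩
    A * A ^ n                 ∎
    where open ≤-Reasoning

  -- Zero top digits are stripped one by one. A negative top digit cannot occur: the lower digits
  -- contribute less than A^n in absolute value, too little to make the number positive.
  expand-leading : ∀ n {H q} → H < A → 0 < q → Expansion n H (pos q) →
                   ∃₂ λ m c → ∃ λ y → 0 < c × c ≤ H × Expansion m H y ×
                     pos q ≡ pos c ℤ.* pos (A ^ m) ℤ.+ y
  expand-leading zero H<A 0<q eq = contradiction (ℤ.+-injective eq) (>⇒≢ 0<q)
  expand-leading (suc n) {q = q} H<A 0<q eq with expand-top n eq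
  ... | pos zero , y , _ , ey , q≡ =
    expand-leading n H<A 0<q (subst (Expansion n _) (sym (trans q≡ (ℤ.+-identityˡ y))) ey)
  ... | pos (suc c) , y , c≤H , ey , q≡ = n , suc c , y , z<s , c≤H , ey , q≡
  ... | -[1+ c ] , y , _ , ey , q≡ = ⊥-elim (<-irrefl refl (begin-strict
    A ^ n                  ≤⟨ m≤m+n (A ^ n) (c * A ^ n) ⟩
    suc c * A ^ n          ≤⟨ m≤n+m (suc c * A ^ n) q ⟩
    q + suc c * A ^ n      ≡⟨ cong abs y≡ ⟨
    abs y                  <⟨ expand-< H<A ey ⟩
    A ^ n                  ∎))
    where
    open ≤-Reasoning
    cancel : ∀ c p y → y ≡ (ℤ.- c ℤ.* p ℤ.+ y) ℤ.+ c ℤ.* p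
    cancel = ℤ-Ring.solve-∀
    y≡ : y ≡ pos (q + suc c * A ^ n)
    y≡ = trans (cancel (pos (suc c)) (pos (A ^ n)) y)
           (trans (cong₂ ℤ._+_ (sym q≡) (sym (ℤ.pos-* (suc c) (A ^ n))))
                  (sym (ℤ.pos-+ q (suc c * A ^ n))))

  -- Horner-style: with p = a + A p′ and E′ p′ = S′ q + R′, the top digit r of
  -- E′ a + A R′ is cancelled against the leading digit c of q.
  pseudo-division : ∀ {H c m y} → 0 < c → c ≤ H → Expansion m H y →
    ∀ n {p} → Expansion n H p → let q = pos c ℤ.* pos (A ^ m) ℤ.+ y ; B = (2 * H * suc H) ^ n in
    ∃ λ E → ∃₂ λ S R → 0 < E × E ≤ B × Expansion n B S × Expansion m B R ×
      pos E ℤ.* p ≡ S ℤ.* q ℤ.+ R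
  pseudo-division {m = m} _ _ _ zero refl =
    1 , 0ℤ , 0ℤ , ≤-refl , ≤-refl , refl , expand-0 m 1 , refl
  pseudo-division {H} {c} {m} {y} 0<c c≤H ey (suc n) (a , p , a≤H , ep , refl)
    with pseudo-division 0<c c≤H ey n ep
  ... | E , S , R , 0<E , E≤B , eS , eR , eq
    with expand-top m {(2 * H * suc H) ^ n + (2 * H * suc H) ^ n * H}
           (expand-+ (expand-shift eR) (expand-const {suc m} {c = pos E ℤ.* a} (s≤s z≤n)
             (≤-trans (≤-reflexive (ℤ.abs-* (pos E) a)) (*-mono-≤ E≤B a≤H))))
  ... | r , R′ , r≤ , eR′ , eq′ =
    c * E , r ℤ.+ pos A ℤ.* (pos c ℤ.* S) , pos c ℤ.* R′ ℤ.- r ℤ.* y ,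
    *-mono-≤ 0<c 0<E ,
    ≤-trans (*-mono-≤ c≤H E≤B) HB≤ ,
    (r , pos c ℤ.* S , ≤-trans r≤ digit≤ , expand-mono ≤-refl HB≤ (expand-scale (pos c) c≤H eS) , refl) ,
    -- The remainder is the largest component: both differences contribute H (B + B H), and their
    -- sum 2 H (H + 1) B dictates the base of `B`.
    expand-mono ≤-refl (≤-reflexive (sum≡ H B))
      (expand-minus (expand-scale (pos c) c≤H eR′) (expand-scale r r≤ ey)) ,
    final
    where
    B = (2 * H * suc H) ^ n
    1≤H : 1 ≤ H
    1≤H = ≤-trans 0<c c≤H
    sum≡ : ∀ H B → H * (B + B * H) + (B + B * H) * H ≡ 2 * H * suc H * B
    sum≡ = ℕ-Ring.solve-∀
    HB≤ : H * B ≤ 2 * H * suc H * B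
    HB≤ = *-monoˡ-≤ B (≤-trans (m≤n*m H 2) (m≤m*n (2 * H) (suc H)))
    digit≤ : B + B * H ≤ 2 * H * suc H * B
    digit≤ = begin
      B + B * H              ≡⟨ *-identityˡ _ ⟨
      1 * (B + B * H)        ≤⟨ *-monoˡ-≤ _ (≤-trans 1≤H (m≤n*m H 2)) ⟩
      2 * H * (B + B * H)    ≡⟨ regroup H B ⟩
      2 * H * suc H * B      ∎
      where
      open ≤-Reasoning
      regroup : ∀ H B → 2 * H * (B + B * H) ≡ 2 * H * suc H * B
      regroup = ℕ-Ring.solve-∀
    q = pos c ℤ.* pos (A ^ m) ℤ.+ y
    final : pos (c * E) ℤ.* (a ℤ.+ pos A ℤ.* p) ≡
            (r ℤ.+ pos A ℤ.* (pos c ℤ.* S)) ℤ.* q ℤ.+ (pos c ℤ.* R′ ℤ.- r ℤ.* y)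
    final = begin
      pos (c * E) ℤ.* (a ℤ.+ pos A ℤ.* p)
        ≡⟨ cong (λ u → u ℤ.* (a ℤ.+ pos A ℤ.* p)) (ℤ.pos-* c E) ⟩
      pos c ℤ.* pos E ℤ.* (a ℤ.+ pos A ℤ.* p)
        ≡⟨ expose (pos c) (pos E) a (pos A) p ⟩
      pos c ℤ.* (pos E ℤ.* a ℤ.+ pos A ℤ.* (pos E ℤ.* p))
        ≡⟨ cong (λ u → pos c ℤ.* (pos E ℤ.* a ℤ.+ pos A ℤ.* u)) eq ⟩
      pos c ℤ.* (pos E ℤ.* a ℤ.+ pos A ℤ.* (S ℤ.* q ℤ.+ R))
        ≡⟨ collect (pos c) (pos E ℤ.* a) (pos A) S q R ⟩
      pos c ℤ.* (pos A ℤ.* R ℤ.+ pos E ℤ.* a) ℤ.+ pos A ℤ.* (pos c ℤ.* S) ℤ.* q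
        ≡⟨ cong (λ u → pos c ℤ.* u ℤ.+ pos A ℤ.* (pos c ℤ.* S) ℤ.* q) eq′ ⟩
      pos c ℤ.* (r ℤ.* pos (A ^ m) ℤ.+ R′) ℤ.+ pos A ℤ.* (pos c ℤ.* S) ℤ.* q
        ≡⟨ cancel (pos c) r (pos (A ^ m)) R′ (pos A ℤ.* (pos c ℤ.* S)) y ⟩
      (r ℤ.+ pos A ℤ.* (pos c ℤ.* S)) ℤ.* q ℤ.+ (pos c ℤ.* R′ ℤ.- r ℤ.* y) ∎
      where
      open ≡-Reasoning
      expose : ∀ c e a b p → c ℤ.* e ℤ.* (a ℤ.+ b ℤ.* p) ≡ c ℤ.* (e ℤ.* a ℤ.+ b ℤ.* (e ℤ.* p))
      expose = ℤ-Ring.solve-∀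
      collect : ∀ c u b s q r → c ℤ.* (u ℤ.+ b ℤ.* (s ℤ.* q ℤ.+ r)) ≡
                c ℤ.* (b ℤ.* r ℤ.+ u) ℤ.+ b ℤ.* (c ℤ.* s) ℤ.* q
      collect = ℤ-Ring.solve-∀
      cancel : ∀ c r p t s y → c ℤ.* (r ℤ.* p ℤ.+ t) ℤ.+ s ℤ.* (c ℤ.* p ℤ.+ y) ≡
               (r ℤ.+ s) ℤ.* (c ℤ.* p ℤ.+ y) ℤ.+ (c ℤ.* t ℤ.- r ℤ.* y)
      cancel = ℤ-Ring.solve-∀

m*n>0 : ∀ {m n} → 0 < m → 0 < n → 0 < m * n
m*n>0 = *-mono-≤

n<2^n : ∀ n → n < 2 ^ n
n<2^n zero    = ≤-refl
n<2^n (suc n) = begin-strict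
  suc n           <⟨ s≤s (n<2^n n) ⟩
  1 + 2 ^ n       ≤⟨ +-monoˡ-≤ (2 ^ n) (m^n>0 2 n) ⟩
  2 ^ n + 2 ^ n   ≡⟨ cong (2 ^ n +_) (+-identityʳ (2 ^ n)) ⟨
  2 ^ suc n       ∎
  where open ≤-Reasoning

-- Multiplied by `v₂`, the difference becomes F (v₁ mod v₂) - R, which is smaller than (F + 1) v₂ in
-- absolute value.
quotient-error : ∀ F S R v₁ v₂ .{{_ : NonZero v₂}} → pos F ℤ.* pos v₁ ≡ S ℤ.* pos v₂ ℤ.+ R →
                 abs R < v₂ → abs (S ℤ.- pos F ℤ.* pos (v₁ / v₂)) ≤ F
quotient-error F S R v₁ v₂ eq R<v₂ = s≤s⁻¹ (*-cancelʳ-< v₂ (abs e) (suc F) e*v₂<)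
  where
  w = v₁ / v₂
  e = S ℤ.- pos F ℤ.* pos w
  e*v₂≡ : e ℤ.* pos v₂ ≡ pos (F * (v₁ % v₂)) ℤ.- R
  e*v₂≡ = begin
    e ℤ.* pos v₂
      ≡⟨ expose S (pos F) (pos w) (pos v₂) R ⟩
    (S ℤ.* pos v₂ ℤ.+ R) ℤ.- R ℤ.- pos F ℤ.* (pos w ℤ.* pos v₂)
      ≡⟨ cong (λ u → u ℤ.- R ℤ.- pos F ℤ.* (pos w ℤ.* pos v₂)) eq ⟨
    pos F ℤ.* pos v₁ ℤ.- R ℤ.- pos F ℤ.* (pos w ℤ.* pos v₂)
      ≡⟨ cong (λ u → pos F ℤ.* u ℤ.- R ℤ.- pos F ℤ.* (pos w ℤ.* pos v₂)) v₁≡ ⟩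
    pos F ℤ.* (pos (v₁ % v₂) ℤ.+ pos w ℤ.* pos v₂) ℤ.- R ℤ.- pos F ℤ.* (pos w ℤ.* pos v₂)
      ≡⟨ cancel (pos F) (pos (v₁ % v₂)) (pos w ℤ.* pos v₂) R ⟩
    pos F ℤ.* pos (v₁ % v₂) ℤ.- R
      ≡⟨ cong (λ u → u ℤ.- R) (ℤ.pos-* F (v₁ % v₂)) ⟨
    pos (F * (v₁ % v₂)) ℤ.- R ∎
    where
    open ≡-Reasoning
    v₁≡ : pos v₁ ≡ pos (v₁ % v₂) ℤ.+ pos w ℤ.* pos v₂
    v₁≡ = trans (cong pos (m≡m%n+[m/n]*n v₁ v₂))
            (trans (ℤ.pos-+ (v₁ % v₂) (w * v₂))
                   (cong (λ u → pos (v₁ % v₂) ℤ.+ u) (ℤ.pos-* w v₂)))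
    expose : ∀ s f w v r → (s ℤ.- f ℤ.* w) ℤ.* v ≡ (s ℤ.* v ℤ.+ r) ℤ.- r ℤ.- f ℤ.* (w ℤ.* v)
    expose = ℤ-Ring.solve-∀
    cancel : ∀ f m u r → f ℤ.* (m ℤ.+ u) ℤ.- r ℤ.- f ℤ.* u ≡ f ℤ.* m ℤ.- r
    cancel = ℤ-Ring.solve-∀
  e*v₂< : abs e * v₂ < suc F * v₂
  e*v₂< = begin-strict
    abs e * v₂                                ≡⟨ ℤ.abs-* e (pos v₂) ⟨
    abs (e ℤ.* pos v₂)                        ≡⟨ cong abs e*v₂≡ ⟩
    abs (pos (F * (v₁ % v₂)) ℤ.- R)           ≤⟨ ℤ.∣i-j∣≤∣i∣+∣j∣ (pos (F * (v₁ % v₂))) R ⟩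
    F * (v₁ % v₂) + abs R                     ≤⟨ +-monoˡ-≤ (abs R) (*-monoʳ-≤ F (<⇒≤ (m%n<n v₁ v₂))) ⟩
    F * v₂ + abs R                            <⟨ +-monoʳ-< (F * v₂) R<v₂ ⟩
    F * v₂ + v₂                               ≡⟨ +-comm (F * v₂) v₂ ⟩
    suc F * v₂                                ∎
    where open ≤-Reasoning

-- Digit expansions with a common denominator

module _ (A : ℕ) where

  -- The denominator `d` makes room for the rational coefficients that arise when digit polynomials
  -- are divided.
  Tame : (n H v : ℕ) → Set
  Tame n H v = ∃ λ d → 0 < d × d ≤ H × Expansion A n H (pos (d * v))

  tame-mono : ∀ {m n H K v} → m ≤ n → H ≤ K → Tame m H v → Tame n K v
  tame-mono m≤n H≤K (d , 0<d , d≤H , ev) = d , 0<d , ≤-trans d≤H H≤K , expand-mono A m≤n H≤K ev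

  tame-const : ∀ {n H c} → 1 ≤ n → 1 ≤ H → c ≤ H → Tame n H c
  tame-const {c = c} 1≤n 1≤H c≤H =
    1 , ≤-refl , 1≤H , expand-const A 1≤n (≤-trans (≤-reflexive (+-identityʳ c)) c≤H)

  tame-ALN : ∀ {H} → 1 ≤ H → Tame 2 H A
  tame-ALN 1≤H = 1 , ≤-refl , 1≤H ,
    subst (Expansion A 2 _) (trans (ℤ.*-identityʳ (pos A)) (cong pos (sym (*-identityˡ A))))
      (expand-shift A (expand-const A {1} {c = ℤ.1ℤ} ≤-refl 1≤H))

  tame-+ : ∀ {n H v w} → Tame n H v → Tame n H w → Tame n (H * H + H * H) (v + w)
  tame-+ {n} {H} {v} {w} (d , 0<d , d≤H , ev) (e , 0<e , e≤H , ew) =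
    d * e , m*n>0 0<d 0<e , ≤-trans (*-mono-≤ d≤H e≤H) (m≤m+n (H * H) (H * H)) ,
    subst (Expansion A n _) eq
      (expand-+ A (expand-scale A (pos e) e≤H ev) (expand-scale A (pos d) d≤H ew))
    where
    open ≡-Reasoning
    regroup : ∀ d e v w → e * (d * v) + d * (e * w) ≡ d * e * (v + w)
    regroup = ℕ-Ring.solve-∀
    eq : pos e ℤ.* pos (d * v) ℤ.+ pos d ℤ.* pos (e * w) ≡ pos (d * e * (v + w))
    eq = begin
      pos e ℤ.* pos (d * v) ℤ.+ pos d ℤ.* pos (e * w)
        ≡⟨ cong₂ ℤ._+_ (ℤ.pos-* e (d * v)) (ℤ.pos-* d (e * w)) ⟨
      pos (e * (d * v)) ℤ.+ pos (d * (e * w))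
        ≡⟨ ℤ.pos-+ (e * (d * v)) (d * (e * w)) ⟨
      pos (e * (d * v) + d * (e * w))
        ≡⟨ cong pos (regroup d e v w) ⟩
      pos (d * e * (v + w)) ∎

  tame-∸ : ∀ {n H v w} → 1 ≤ n → 1 ≤ H → Tame n H v → Tame n H w → Tame n (H * H + H * H) (v ∸ w)
  tame-∸ {n} {H} {v} {w} 1≤n 1≤H (d , 0<d , d≤H , ev) (e , 0<e , e≤H , ew) with v ≤? w
  ... | yes v≤w rewrite m≤n⇒m∸n≡0 v≤w =
    tame-const 1≤n (≤-trans (*-mono-≤ 1≤H 1≤H) (m≤m+n (H * H) (H * H))) z≤n
  ... | no v≰w =
    d * e , m*n>0 0<d 0<e , ≤-trans (*-mono-≤ d≤H e≤H) (m≤m+n (H * H) (H * H)) ,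
    subst (Expansion A n _) eq
      (expand-minus A (expand-scale A (pos e) e≤H ev) (expand-scale A (pos d) d≤H ew))
    where
    open ≡-Reasoning
    regroup : ∀ d e w u → e * (d * (u + w)) ≡ d * e * u + d * (e * w)
    regroup = ℕ-Ring.solve-∀
    cancel : ∀ u w → u ℤ.+ w ℤ.- w ≡ u
    cancel = ℤ-Ring.solve-∀
    eq : pos e ℤ.* pos (d * v) ℤ.- pos d ℤ.* pos (e * w) ≡ pos (d * e * (v ∸ w))
    eq = begin
      pos e ℤ.* pos (d * v) ℤ.- pos d ℤ.* pos (e * w)
        ≡⟨ cong₂ ℤ._-_ (ℤ.pos-* e (d * v)) (ℤ.pos-* d (e * w)) ⟨
      pos (e * (d * v)) ℤ.- pos (d * (e * w))
        ≡⟨ cong (λ u → pos (e * (d * u)) ℤ.- pos (d * (e * w))) (m∸n+n≡m (≰⇒≥ v≰w)) ⟨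
      pos (e * (d * (v ∸ w + w))) ℤ.- pos (d * (e * w))
        ≡⟨ cong (λ u → pos u ℤ.- pos (d * (e * w))) (regroup d e w (v ∸ w)) ⟩
      pos (d * e * (v ∸ w) + d * (e * w)) ℤ.- pos (d * (e * w))
        ≡⟨ cong (λ u → u ℤ.- pos (d * (e * w))) (ℤ.pos-+ (d * e * (v ∸ w)) (d * (e * w))) ⟩
      pos (d * e * (v ∸ w)) ℤ.+ pos (d * (e * w)) ℤ.- pos (d * (e * w))
        ≡⟨ cancel (pos (d * e * (v ∸ w))) (pos (d * (e * w))) ⟩
      pos (d * e * (v ∸ w)) ∎

  tame-* : ∀ {n H v w} → 1 ≤ n → Tame n H v → Tame n H w → Tame (n + n) (n * (H * H)) (v * w)
  tame-* {n} {H} {v} {w} 1≤n (d , 0<d , d≤H , ev) (e , 0<e , e≤H , ew) =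
    d * e , m*n>0 0<d 0<e ,
    ≤-trans (*-mono-≤ d≤H e≤H) (≤-trans (≤-reflexive (sym (*-identityˡ (H * H)))) (*-monoˡ-≤ (H * H) 1≤n)) ,
    subst (Expansion A (n + n) _)
      (trans (sym (ℤ.pos-* (d * v) (e * w))) (cong pos (regroup d v e w)))
      (expand-* A ev ew)
    where
    regroup : ∀ d v e w → d * v * (e * w) ≡ d * e * (v * w)
    regroup = ℕ-Ring.solve-∀

  -- Pseudo-division of the two expansions gives E d v = e S w + R with ∣R∣ < w. Hence e S differs
  -- from E d (v ÷ w) by at most E d, and this error is a constant that the lowest digit absorbs.
  tame-÷ : ∀ {n H v w} → let B = (2 * H * suc H) ^ n in
           1 ≤ n → H + H * B < A → Tame n H v → Tame n H w → Tame n (H * B + B * H) (v ÷ w)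
  tame-÷ {n} {H} {v} {zero} 1≤n H+HB<A (d , 0<d , d≤H , ev) _ = tame-const 1≤n 1≤ z≤n
    where
    B = (2 * H * suc H) ^ n
    1≤H : 1 ≤ H
    1≤H = ≤-trans 0<d d≤H
    1≤ : 1 ≤ H * B + B * H
    1≤ = ≤-trans (m*n>0 1≤H (m^n>0 (2 * H * suc H) {{>-nonZero (m*n>0 {2 * H} (m*n>0 {2} z<s 1≤H) z<s)}} n))
                 (m≤m+n (H * B) (B * H))
  tame-÷ {n} {H} {v} {w@(suc _)} 1≤n H+HB<A (d , 0<d , d≤H , ev) (e , 0<e , e≤H , ew)
    with expand-leading A n (≤-<-trans (m≤m+n H _) H+HB<A) (m*n>0 0<e (z<s {_})) ew
  ... | m , c , y , 0<c , c≤H , ey , w≡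
    with pseudo-division A 0<c c≤H ey n ev
  ... | E , S , R , 0<E , E≤B , eS , eR , eq =
    E * d , m*n>0 0<E 0<d , ≤-trans (*-mono-≤ E≤B d≤H) (m≤n+m (B * H) (H * B)) ,
    subst (Expansion A n _) (trans (cancel (pos e ℤ.* S) (pos (E * d) ℤ.* pos (v / w)))
                                   (sym (ℤ.pos-* (E * d) (v / w))))
      (expand-minus A (expand-scale A (pos e) e≤H eS)
        (expand-const A 1≤n (≤-trans (quotient-error (E * d) (pos e ℤ.* S) R v w eq′ R<w)
                                     (*-mono-≤ E≤B d≤H))))
    where
    B = (2 * H * suc H) ^ n
    cancel : ∀ s t → s ℤ.- (s ℤ.- t) ≡ t
    cancel = ℤ-Ring.solve-∀
    eq′ : pos (E * d) ℤ.* pos v ≡ pos e ℤ.* S ℤ.* pos w ℤ.+ R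
    eq′ = begin
      pos (E * d) ℤ.* pos v        ≡⟨ cong (λ u → u ℤ.* pos v) (ℤ.pos-* E d) ⟩
      pos E ℤ.* pos d ℤ.* pos v    ≡⟨ ℤ.*-assoc (pos E) (pos d) (pos v) ⟩
      pos E ℤ.* (pos d ℤ.* pos v)  ≡⟨ cong (λ u → pos E ℤ.* u) (ℤ.pos-* d v) ⟨
      pos E ℤ.* pos (d * v)        ≡⟨ eq ⟩
      S ℤ.* (pos c ℤ.* pos (A ^ m) ℤ.+ y) ℤ.+ R  ≡⟨ cong (λ u → S ℤ.* u ℤ.+ R) (trans (sym w≡) (ℤ.pos-* e w)) ⟩
      S ℤ.* (pos e ℤ.* pos w) ℤ.+ R  ≡⟨ regroup S (pos e) (pos w) R ⟩
      pos e ℤ.* S ℤ.* pos w ℤ.+ R  ∎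
      where
      open ≡-Reasoning
      regroup : ∀ s e w r → s ℤ.* (e ℤ.* w) ℤ.+ r ≡ e ℤ.* s ℤ.* w ℤ.+ r
      regroup = ℤ-Ring.solve-∀
    -- Since e w = c A^m + y with c > 0, the power A^m is at most ∣y∣ + e w. As ∣y∣ + e ∣R∣ stays
    -- below A^m by the size of its digits, comparing the two gives ∣R∣ < w.
    small : abs y + e * abs R < A ^ m
    small = expand-< A H+HB<A (expand-+ A (expand-∣∣ A ey)
      (subst (Expansion A m _) (sym (ℤ.pos-* e (abs R))) (expand-scale A (pos e) e≤H (expand-∣∣ A eR))))
    large : A ^ m ≤ abs y + e * w
    large = begin
      A ^ m                       ≤⟨ m≤n*m (A ^ m) c {{>-nonZero 0<c}} ⟩
      abs (pos (c * A ^ m))       ≡⟨ cong abs (trans (ℤ.pos-* c (A ^ m)) (sym (add-sub (pos c ℤ.* pos (A ^ m)) y))) ⟩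
      abs (pos c ℤ.* pos (A ^ m) ℤ.+ y ℤ.- y) ≡⟨ cong (λ u → abs (u ℤ.- y)) w≡ ⟨
      abs (pos (e * w) ℤ.- y)     ≤⟨ ℤ.∣i-j∣≤∣i∣+∣j∣ (pos (e * w)) y ⟩
      e * w + abs y               ≡⟨ +-comm (e * w) (abs y) ⟩
      abs y + e * w               ∎
      where
      open ≤-Reasoning
      add-sub : ∀ u y → u ℤ.+ y ℤ.- y ≡ u
      add-sub = ℤ-Ring.solve-∀
    R<w : abs R < w
    R<w = *-cancelˡ-< e (abs R) w (+-cancelˡ-< (abs y) _ _ (<-≤-trans small large))

  -- In d v = c + A y the multiple A y is at most H v + H in absolute value, hence less than A, so y
  -- = 0 and only the lowest digit remains.
  tame-fixed : ∀ {n H v} → H * v + H < A → Tame n H v → v ≤ H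
  tame-fixed {zero} {H} {v} _ (d@(suc _) , 0<d , d≤H , ev) =
    ≤-trans (m≤n*m v d) (≤-trans (≤-reflexive (ℤ.+-injective ev)) z≤n)
  tame-fixed {suc n} {H} {v} large (d@(suc _) , 0<d , d≤H , c , y , c≤H , _ , eq) =
    ≤-trans (m≤n*m v d) (≤-trans (≤-reflexive (cong abs (trans eq c+Ay≡c))) c≤H)
    where
    add-sub : ∀ c u → u ≡ c ℤ.+ u ℤ.- c
    add-sub = ℤ-Ring.solve-∀
    Ay<A : A * abs y < A * 1
    Ay<A = begin-strict
      A * abs y                     ≡⟨ ℤ.abs-* (pos A) y ⟨
      abs (pos A ℤ.* y)             ≡⟨ cong abs (add-sub c (pos A ℤ.* y)) ⟩
      abs (c ℤ.+ pos A ℤ.* y ℤ.- c) ≡⟨ cong (λ u → abs (u ℤ.- c)) eq ⟨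
      abs (pos (d * v) ℤ.- c)       ≤⟨ ℤ.∣i-j∣≤∣i∣+∣j∣ (pos (d * v)) c ⟩
      d * v + abs c                 ≤⟨ +-mono-≤ (*-monoˡ-≤ v d≤H) c≤H ⟩
      H * v + H                     <⟨ large ⟩
      A                             ≡⟨ *-identityʳ A ⟨
      A * 1                         ∎
      where open ≤-Reasoning
    c+Ay≡c : c ℤ.+ pos A ℤ.* y ≡ c
    c+Ay≡c = trans (cong (λ u → c ℤ.+ pos A ℤ.* u) (ℤ.∣i∣≡0⇒i≡0 (n<1⇒n≡0 (*-cancelˡ-< A _ _ Ay<A))))
               (trans (cong (λ u → c ℤ.+ u) (ℤ.*-zeroʳ (pos A))) (ℤ.+-identityʳ c))

-- The values an ARAM can reach

⇓-deterministic : ∀ {S : Set} {step s t t′} {s′ s″ : S} →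
                  step ⊢ s ⇓⟨ t ⟩ s′ → step ⊢ s ⇓⟨ t′ ⟩ s″ → t ≡ t′ × s′ ≡ s″
⇓-deterministic (stop _)  (stop _)   = refl , refl
⇓-deterministic (stop p)  (next q _) = contradiction (trans (sym p) q) λ ()
⇓-deterministic (next p _) (stop q)  = contradiction (trans (sym q) p) λ ()
⇓-deterministic (next p d) (next q e) with just-injective (trans (sym p) q)
... | refl with ⇓-deterministic d e
... | refl , refl = refl , refl

∈⇒≤sum : ∀ {x xs} → x ∈ᴸ xs → x ≤ sum xs
∈⇒≤sum {xs = y ∷ xs} (here refl) = m≤m+n y (sum xs)
∈⇒≤sum {xs = y ∷ xs} (there x∈)  = ≤-trans (∈⇒≤sum x∈) (m≤n+m (sum xs) y)

-- Growth of the digit bound in one operation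

module _ {n H : ℕ} (1≤n : 1 ≤ n) (4≤H : 4 ≤ H) where

  private
    instance
      H≢0 : NonZero H
      H≢0 = >-nonZero (≤-trans (s≤s z≤n) 4≤H)

    B = (2 * H * suc H) ^ n

    2≤H : 2 ≤ H
    2≤H = ≤-trans (s≤s (s≤s z≤n)) 4≤H

    1≤H : 1 ≤ H
    1≤H = ≤-trans (s≤s z≤n) 4≤H

    -- The exponent 2 + 3 n is the worst case. Division reaches it, with two factors `H` next to
    -- `B ≤ H ^ (3 * n)`.
    H^≤ : ∀ {k} → k ≤ 2 + 3 * n → H ^ k ≤ H ^ (5 * n)
    H^≤ k≤ = ^-monoʳ-≤ H (≤-trans k≤ (begin
      2 + 3 * n     ≤⟨ +-monoˡ-≤ (3 * n) (*-monoʳ-≤ 2 1≤n) ⟩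
      2 * n + 3 * n ≡⟨ *-distribʳ-+ n 2 3 ⟨
      5 * n         ∎))
      where open ≤-Reasoning

  sum-bound : H * H + H * H ≤ H ^ (5 * n)
  sum-bound = begin
    H * H + H * H   ≡⟨ double H ⟩
    2 * H ^ 2       ≤⟨ *-monoˡ-≤ (H ^ 2) 2≤H ⟩
    H ^ 3           ≤⟨ H^≤ (≤-trans (*-monoʳ-≤ 3 1≤n) (m≤n+m (3 * n) 2)) ⟩
    H ^ (5 * n)     ∎
    where
    open ≤-Reasoning
    double : ∀ H → H * H + H * H ≡ 2 * (H * (H * 1))
    double = ℕ-Ring.solve-∀

  product-bound : n * (H * H) ≤ H ^ (5 * n)
  product-bound = begin
    n * (H * H)     ≤⟨ *-monoˡ-≤ (H * H) (≤-trans (<⇒≤ (n<2^n n)) (^-monoˡ-≤ n 2≤H)) ⟩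
    H ^ n * (H * H) ≡⟨ regroup (H ^ n) H ⟩
    H ^ (2 + n)     ≤⟨ H^≤ (+-monoʳ-≤ 2 (m≤n*m n 3)) ⟩
    H ^ (5 * n)     ∎
    where
    open ≤-Reasoning
    regroup : ∀ p H → p * (H * H) ≡ H * (H * p)
    regroup = ℕ-Ring.solve-∀

  private
    1≤B : 1 ≤ B
    1≤B = m^n>0 (2 * H * suc H) {{>-nonZero (*-mono-≤ {1} {2 * H} (≤-trans 1≤H (m≤n*m H 2)) (s≤s z≤n))}} n

    B≤ : B ≤ H ^ (3 * n)
    B≤ = begin
      (2 * H * suc H) ^ n ≤⟨ ^-monoˡ-≤ n base≤ ⟩
      (H ^ 3) ^ n         ≡⟨ ^-*-assoc H 3 n ⟩
      H ^ (3 * n)         ∎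
      where
      open ≤-Reasoning
      regroup : ∀ H → 2 * H * (H + H) ≡ 4 * (H * (H * 1))
      regroup = ℕ-Ring.solve-∀
      base≤ : 2 * H * suc H ≤ H ^ 3
      base≤ = begin
        2 * H * suc H   ≤⟨ *-monoʳ-≤ (2 * H) (+-monoˡ-≤ H 1≤H) ⟩
        2 * H * (H + H) ≡⟨ regroup H ⟩
        4 * H ^ 2       ≤⟨ *-monoˡ-≤ (H ^ 2) 4≤H ⟩
        H ^ 3           ∎

  quotient-bound : H * B + B * H ≤ H ^ (5 * n)
  quotient-bound = begin
    H * B + B * H         ≡⟨ regroup H B ⟩
    2 * (H * B)           ≤⟨ *-mono-≤ 2≤H (*-monoʳ-≤ H B≤) ⟩
    H ^ (2 + 3 * n)       ≤⟨ H^≤ ≤-refl ⟩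
    H ^ (5 * n)           ∎
    where
    open ≤-Reasoning
    regroup : ∀ H B → H * B + B * H ≡ 2 * (H * B)
    regroup = ℕ-Ring.solve-∀

  remainder-bound : H + H * B ≤ H ^ (5 * n)
  remainder-bound = begin
    H + H * B         ≤⟨ +-monoˡ-≤ (H * B) (≤-trans (≤-reflexive (sym (*-identityˡ H))) (*-monoˡ-≤ H 1≤B)) ⟩
    B * H + H * B     ≡⟨ +-comm (B * H) (H * B) ⟩
    H * B + B * H     ≤⟨ quotient-bound ⟩
    H ^ (5 * n)       ∎
    where open ≤-Reasoning

  height-increases : H ≤ H ^ (5 * n)
  height-increases = begin
    H           ≤⟨ m≤m*n H H ⟩
    H * H       ≤⟨ m≤m+n (H * H) (H * H) ⟩
    H * H + H * H ≤⟨ sum-bound ⟩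
    H ^ (5 * n) ∎
    where open ≤-Reasoning

  -- One pair of bounds serves all four operations: `mul` needs twice the digits, and `div` needs a
  -- power of `H` whose exponent grows with `n`.
  tame-arith : ∀ {A v w} o → H ^ (5 * n) < A → Tame A n H v → Tame A n H w →
               Tame A (n + n) (H ^ (5 * n)) (arith o v w)
  tame-arith {A} add   H′<A tv tw = tame-mono A (m≤m+n n n) sum-bound (tame-+ A tv tw)
  tame-arith {A} monus H′<A tv tw = tame-mono A (m≤m+n n n) sum-bound (tame-∸ A 1≤n 1≤H tv tw)
  tame-arith {A} mul   H′<A tv tw = tame-mono A ≤-refl product-bound (tame-* A 1≤n tv tw)
  tame-arith {A} div   H′<A tv tw =
    tame-mono A (m≤m+n n n) quotient-bound (tame-÷ A 1≤n (≤-<-trans remainder-bound H′<A) tv tw)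

operandSize : Operand → ℕ
operandSize (const c) = c
operandSize (load _)  = 0

-- Only literals that can enter a register count. Those compared by a jump never become register
-- contents.
instrSize : Instr → ℕ
instrSize (assign _ a)    = operandSize a
instrSize (apply _ _ a b) = operandSize a + operandSize b
instrSize (jumpEq _ _ _)  = 0

programSize : RAM → ℕ
programSize r = sum (map instrSize r)

instrSize≤programSize : ∀ r i {ins} → nth r i ≡ just ins → instrSize ins ≤ programSize r
instrSize≤programSize (ins ∷ r) zero    refl = m≤m+n (instrSize ins) (programSize r)
instrSize≤programSize (ins ∷ r) (suc i) eq   =
  ≤-trans (instrSize≤programSize r i eq) (m≤n+m (programSize r) (instrSize ins))
instrSize≤programSize []        zero    ()
instrSize≤programSize []        (suc i) ()

update-preserves : ∀ (P : ℕ → Set) R k v → (∀ j → P (R j)) → P v → ∀ j → P ((R [ k ≔ v ]) j)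
update-preserves P R k v PR Pv j with j ≡ᵇ k
... | true  = Pv
... | false = PR j

module _ {A n H : ℕ} (1≤n : 1 ≤ n) (4≤H : 4 ≤ H) where

  tame-value : ∀ {R} a → operandSize a ≤ H → (∀ k → Tame A n H (R k)) → Tame A n H (value R a)
  tame-value     (const c) c≤H TR = tame-const A 1≤n (≤-trans (s≤s z≤n) 4≤H) c≤H
  tame-value {R} (load l)  _   TR = TR (address R l)

  -- Tameness is kept for all registers at once, so it does not matter which register an indirect
  -- address selects or which way a jump goes.
  tame-exec : ∀ {σ} ins → instrSize ins ≤ H → H ^ (5 * n) < A → (∀ k → Tame A n H (regs σ k)) →
              ∀ k → Tame A (n + n) (H ^ (5 * n)) (regs (exec ins σ) k)
  tame-exec {σ} (assign l a) a≤H H′<A TR =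
    update-preserves (Tame A (n + n) (H ^ (5 * n))) (regs σ) (address (regs σ) l) _
      (λ j → weaken (TR j)) (weaken (tame-value a a≤H TR))
    where
    weaken : ∀ {v} → Tame A n H v → Tame A (n + n) (H ^ (5 * n)) v
    weaken = tame-mono A (m≤m+n n n) (height-increases 1≤n 4≤H)
  tame-exec {σ} (apply o l a b) ab≤H H′<A TR =
    update-preserves (Tame A (n + n) (H ^ (5 * n))) (regs σ) (address (regs σ) l) _
      (λ j → tame-mono A (m≤m+n n n) (height-increases 1≤n 4≤H) (TR j))
      (tame-arith 1≤n 4≤H o H′<A (tame-value a (m+n≤o⇒m≤o _ ab≤H) TR)
                                 (tame-value b (m+n≤o⇒n≤o _ ab≤H) TR))
  tame-exec (jumpEq a b t) _ _ TR k = tame-mono A (m≤m+n n n) (height-increases 1≤n 4≤H) (TR k)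

height : (n H t : ℕ) → ℕ
height n H zero    = H
height n H (suc t) = height (n + n) (H ^ (5 * n)) t

height-≥ : ∀ {n H} t → 1 ≤ n → 4 ≤ H → H ≤ height n H t
height-≥ zero    1≤n 4≤H = ≤-refl
height-≥ {n} (suc t) 1≤n 4≤H = ≤-trans H≤ (height-≥ t (≤-trans 1≤n (m≤m+n n n)) (≤-trans 4≤H H≤))
  where H≤ = height-increases 1≤n 4≤H

-- Each step multiplies the exponent of `H` by 5 n ≤ 2^(3 + k) and, as the digits double, raises `k`
-- by one. The binary logarithm of the exponent is therefore quadratic in `t`.
height-≤ : ∀ k t {n H} → .{{NonZero H}} → n ≤ 2 ^ k → height n H t ≤ H ^ (2 ^ (t * (k + (t + 3))))
height-≤ k zero {H = H} _ = ≤-reflexive (sym (*-identityʳ H))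
height-≤ k (suc t) {n} {H} n≤2^k = begin
  height (n + n) (H ^ (5 * n)) t
    ≤⟨ height-≤ (suc k) t {{m^n≢0 H (5 * n)}}
         (≤-trans (+-mono-≤ n≤2^k n≤2^k) (≤-reflexive (cong (2 ^ k +_) (sym (+-identityʳ (2 ^ k)))))) ⟩
  (H ^ (5 * n)) ^ (2 ^ (t * (suc k + (t + 3))))
    ≡⟨ ^-*-assoc H (5 * n) _ ⟩
  H ^ (5 * n * 2 ^ (t * (suc k + (t + 3))))
    ≤⟨ ^-monoʳ-≤ H (*-monoˡ-≤ (2 ^ (t * (suc k + (t + 3)))) (*-mono-≤ 5≤8 n≤2^k)) ⟩
  H ^ (2 ^ 3 * 2 ^ k * 2 ^ (t * (suc k + (t + 3))))
    ≡⟨ cong (H ^_) (trans (cong (_* 2 ^ (t * (suc k + (t + 3)))) (sym (^-distribˡ-+-* 2 3 k)))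
                          (sym (^-distribˡ-+-* 2 (3 + k) _))) ⟩
  H ^ (2 ^ (3 + k + t * (suc k + (t + 3))))
    -- The target exponent exceeds this one by exactly `suc t`.
    ≤⟨ ^-monoʳ-≤ H (^-monoʳ-≤ 2 (≤-trans (m≤m+n (3 + k + t * (suc k + (t + 3))) (suc t)) (≤-reflexive (regroup k t)))) ⟩
  H ^ (2 ^ (suc t * (k + (suc t + 3)))) ∎
  where
  open ≤-Reasoning
  5≤8 : 5 ≤ 8
  5≤8 = m≤m+n 5 3
  regroup : ∀ k t → 3 + k + t * (suc k + (t + 3)) + suc t ≡ suc t * (k + (suc t + 3))
  regroup = ℕ-Ring.solve-∀

-- Heights never decrease, so an `A` above the final height is large enough for every division on
-- the way.
tame-run : ∀ {A r n H t σ σ′} → 1 ≤ n → 4 ≤ H → programSize r ≤ H → height n H t < A →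
           (∀ k → Tame A n H (regs σ k)) → ramStep r ⊢ σ ⇓⟨ t ⟩ σ′ →
           ∃ λ m → Tame A m (height n H t) (output σ′)
tame-run {n = n} _ _ _ _ TR (stop _) = n , TR 0
tame-run {A} {r} {n} {H} {suc t} {σ} 1≤n 4≤H r≤H h<A TR (next eq run)
  with nth r (pc σ) in fetch
tame-run {A} {r} {n} {H} {suc t} {σ} 1≤n 4≤H r≤H h<A TR (next refl run) | just ins =
  tame-run (≤-trans 1≤n (m≤m+n n n)) (≤-trans 4≤H H≤) (≤-trans r≤H H≤) h<A
    (tame-exec 1≤n 4≤H ins (≤-trans (instrSize≤programSize r (pc σ) fetch) r≤H)
      (≤-<-trans (height-≥ t (≤-trans 1≤n (m≤m+n n n)) (≤-trans 4≤H H≤)) h<A) TR)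
    run
  where H≤ = height-increases 1≤n 4≤H

-- The running time is bounded uniformly in `A`, so the digit bound `M` is fixed before `A` is
-- chosen. An `A` that is large relative to `M` and to the output then forces the output to be at
-- most `M`.
ARAM-output-bound : ∀ {r f inp b} → ARAMComputes r f → ARAMTime≤ r inp b →
                    f inp ≤ (4 + programSize r + inp) ^ (2 ^ (b * (1 + (b + 3))))
ARAM-output-bound {r} {f} {inp} {b} (ρ , computes , almost) time
  with almost inp
... | exceptions , agree
  with M ← (4 + programSize r + inp) ^ (2 ^ (b * (1 + (b + 3)))) in M≡
  -- The summands put `A` beyond the digit bound, beyond every exception, and beyond the threshold
  -- of `tame-fixed`.
  with A ← suc (M + sum exceptions + (M * f inp + M)) in A≡
  with computes inp A | time A
... | _ , σ , run , out≡ | t , _ , (_ , run′ , _) , t≤b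
  with ⇓-deterministic run run′
... | refl , refl = tame-fixed A (≤-trans (s≤s (m≤n+m _ (M + sum exceptions))) (≤-reflexive A≡))
        (tame-mono A ≤-refl h≤M (subst (Tame A m (height 2 H t)) out≡f (proj₂ tame)))
  where
  H = 4 + programSize r + inp
  h≤M : height 2 H t ≤ M
  h≤M = ≤-trans (height-≤ 1 t ≤-refl) (≤-trans
    (^-monoʳ-≤ H (^-monoʳ-≤ 2 (*-mono-≤ t≤b (+-monoʳ-≤ 1 (+-monoˡ-≤ 3 t≤b))))) (≤-reflexive M≡))
  A∉ : ∀ {e} → e ∈ᴸ exceptions → e < A
  A∉ e∈ = ≤-trans (s≤s (≤-trans (∈⇒≤sum e∈) (≤-trans (m≤n+m _ M) (m≤m+n _ _)))) (≤-reflexive A≡)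
  out≡f : output σ ≡ f inp
  out≡f = trans out≡ (agree A λ A∈ → <-irrefl refl (A∉ A∈))
  M<A : M < A
  M<A = ≤-trans (s≤s (≤-trans (m≤m+n M _) (m≤m+n _ _))) (≤-reflexive A≡)
  -- The second input is A itself, with digits 0 and 1, so the run starts with two digits.
  init : ∀ k → Tame A 2 H (initial (inp ∷ A ∷ []) k)
  init zero                = tame-const A (s≤s z≤n) (s≤s z≤n) (m≤n+m inp _)
  init (suc zero)          = tame-ALN A (s≤s z≤n)
  init (suc (suc zero))    = tame-const A (s≤s z≤n) (s≤s z≤n) z≤n
  init (suc (suc (suc k))) = tame-const A (s≤s z≤n) (s≤s z≤n) z≤n
  tame = tame-run (s≤s z≤n) (m≤m+n 4 _) (≤-trans (m≤n+m _ 4) (m≤m+n _ inp)) (≤-<-trans h≤M M<A) init run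
  m = proj₁ tame

-- An ARAM is an ASRAM making a single call

-- Registers are functions and are compared only pointwise. Runs are therefore transported along a
-- relation that both step functions respect, with the same number of steps.
⇓-simulate : ∀ {S S′ : Set} {step : S → Maybe S} {step′ : S′ → Maybe S′} {_~_ : S → S′ → Set} →
             (∀ {s s′} → s ~ s′ → Pointwise _~_ (step s) (step′ s′)) →
             ∀ {s s′ t u} → s ~ s′ → step ⊢ s ⇓⟨ t ⟩ u → ∃ λ u′ → step′ ⊢ s′ ⇓⟨ t ⟩ u′ × u ~ u′
⇓-simulate {step = step} {step′} sim {s} {s′} s~s′ run
  with step s in eq | step′ s′ in eq′ | sim s~s′ | run
... | _ | _ | nothing   | stop _ = s′ , stop eq′ , s~s′
... | _ | _ | just _    | stop p = contradiction (trans (sym p) eq) λ ()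
... | _ | _ | nothing   | next p _ = contradiction (trans (sym eq) p) λ ()
... | _ | _ | just u~u′ | next p run′ with trans (sym eq) p
... | refl with ⇓-simulate sim u~u′ run′
... | u′ , run″ , end = u′ , next eq′ run″ , end

update-cong : ∀ {R R′ k k′ v v′} → R ≗ R′ → k ≡ k′ → v ≡ v′ → R [ k ≔ v ] ≗ R′ [ k′ ≔ v′ ]
update-cong {k = k} R≗R′ refl refl j with j ≡ᵇ k
... | true  = refl
... | false = R≗R′ j

address-cong : ∀ {R R′} l → R ≗ R′ → address R l ≡ address R′ l
address-cong (direct k)   R≗R′ = refl
address-cong (indirect k) R≗R′ = R≗R′ k

value-cong : ∀ {R R′} a → R ≗ R′ → value R a ≡ value R′ a
value-cong           (const c) R≗R′ = refl
value-cong {R′ = R′} (load l)  R≗R′ = trans (R≗R′ _) (cong R′ (address-cong l R≗R′))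

shiftInstr : Instr → Instr
shiftInstr (jumpEq a b t) = jumpEq a b (suc t)
shiftInstr ins            = ins

-- The call fills `R[1]`, where an ARAM finds its second input. The place it takes at the front is
-- why jump targets move by one.
embed : RAM → ASRAM
embed r = callALN (direct 1) ∷ map (ram ∘ shiftInstr) r

_~_ : State → ASState → Set
σ ~ (σ′ , _) = suc (pc σ) ≡ pc σ′ × regs σ ≗ regs σ′

nth-map : ∀ {X Y : Set} (f : X → Y) xs n → nth (map f xs) n ≡ Maybe.map f (nth xs n)
nth-map f []       zero    = refl
nth-map f []       (suc n) = refl
nth-map f (x ∷ xs) zero    = refl
nth-map f (x ∷ xs) (suc n) = nth-map f xs n

exec-shift : ∀ {A σ s} ins → σ ~ s → exec ins σ ~ asExec A (ram (shiftInstr ins)) s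
exec-shift (assign l a)    (refl , R≗R′) =
  refl , update-cong R≗R′ (address-cong l R≗R′) (value-cong a R≗R′)
exec-shift (apply o l a b) (refl , R≗R′) =
  refl , update-cong R≗R′ (address-cong l R≗R′) (cong₂ (arith o) (value-cong a R≗R′) (value-cong b R≗R′))
exec-shift {σ = ⟨ _ , R ⟩} {⟨ _ , R′ ⟩ , _} (jumpEq a b t) (refl , R≗R′)
  rewrite value-cong a R≗R′ | value-cong b R≗R′ with value R′ a ≡ᵇ value R′ b
... | true  = refl , R≗R′
... | false = refl , R≗R′

embed-step : ∀ {A r σ s} → σ ~ s → Pointwise _~_ (ramStep r σ) (asStep A (embed r) s)
embed-step {A} {r} {σ} {s@(⟨ _ , _ ⟩ , _)} σ~s@(refl , _)
  rewrite nth-map (ram ∘ shiftInstr) r (pc σ) with nth r (pc σ)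
... | nothing  = nothing
... | just ins = just (exec-shift {A} {σ} {s} ins σ~s)

embed-halts : ∀ {r inp A t v} → RAMHalts r (inp ∷ A 0 ∷ []) t v → ASRAMHalts A (embed r) inp (suc t) v
embed-halts {r} {inp} {A} (σ , run , out)
  with ⇓-simulate {_~_ = _~_} (λ {σ} {s} → embed-step {A} {r} {σ} {s}) (refl , initial≗) run
  where
  initial≗ : initial (inp ∷ A 0 ∷ []) ≗ (initial (inp ∷ []) [ 1 ≔ A 0 ])
  initial≗ 0                   = refl
  initial≗ 1                   = refl
  initial≗ 2                   = refl
  initial≗ (suc (suc (suc k))) = refl
... | (σ′ , i) , run′ , _ , R≗R′ = σ′ , i , next refl run′ , trans (sym (R≗R′ 0)) out

eval-suc : ∀ p → ∃ λ q → ∀ n → eval q n ≡ suc (eval p n)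
eval-suc []       = 1 ∷ [] , λ n → cong suc (*-zeroʳ n)
eval-suc (c ∷ cs) = suc c ∷ cs , λ n → refl

ARAM⊆ASRAM : PolyTimeARAM ⊆ PolyTimeASRAM
ARAM⊆ASRAM {f} (r , (ρ , computes , almost) , p , time) =
  embed r , computes′ , proj₁ (eval-suc p) , time′
  where
  computes′ : ASRAMComputes (embed r) f
  computes′ inp with almost inp
  -- A first term above the sum of the exceptions is none of them. This survives incrementing any
  -- term, and later terms are free.
  ... | exceptions , agree = (λ A → sum exceptions < A 0) , als , halts
    where
    als : IsALS (λ A → sum exceptions < A 0)
    als .IsALS.nonempty = (λ _ → suc (sum exceptions)) , ≤-refl
    als .IsALS.increment zero A large =
      (λ _ → suc (A 0)) , m≤n⇒m≤1+n large , refl , λ _ ()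
    als .IsALS.increment (suc i) A large =
      A [ suc i ≔ suc (A (suc i)) ] , large , updated , kept
      where
      updated : (A [ suc i ≔ suc (A (suc i)) ]) (suc i) ≡ suc (A (suc i))
      updated with i ≡ᵇ i | ≡⇒≡ᵇ i i refl
      ... | true | _ = refl
      kept : ∀ j → j < suc i → (A [ suc i ≔ suc (A (suc i)) ]) j ≡ A j
      kept j j<i with j ≡ᵇ suc i | ≡ᵇ⇒≡ j (suc i)
      ... | false | _  = refl
      ... | true  | eq = contradiction (eq tt) (<⇒≢ j<i)
    halts : ∀ A → sum exceptions < A 0 → ∃ λ t → ASRAMHalts A (embed r) inp t (f inp)
    halts A large with computes inp (A 0)
    ... | t , run = suc t , embed-halts {A = A} (subst (RAMHalts r _ t) (agree (A 0) (<⇒≱ large ∘ ∈⇒≤sum)) run)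
  time′ : ∀ inp → ASRAMTime≤ (embed r) inp (eval (proj₁ (eval-suc p)) (bitLength inp))
  time′ inp A with time inp (A 0)
  ... | t , v , run , t≤ = suc t , v , embed-halts {A = A} run ,
    ≤-trans (s≤s t≤) (≤-reflexive (sym (proj₂ (eval-suc p) (bitLength inp))))

-- An ASRAM for the triple exponential

infixr 5 _◂_
_◂_ : ℕ → (ℕ → ℕ) → (ℕ → ℕ)
(x ◂ R) zero    = x
(x ◂ R) (suc j) = R j

-- Registers 0–5: input and output; pointer into the array a; the power P = aₖᴱ;
-- the current aₖ; two scratch registers.  The array, with a₀ = 2 and aᵢ₊₁ the
-- i-th arbitrary large number, occupies the registers from 6 on.
memory : (x₀ x₁ x₂ x₃ x₄ x₅ : ℕ) → (ℕ → ℕ) → Registers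
memory x₀ x₁ x₂ x₃ x₄ x₅ a = x₀ ◂ x₁ ◂ x₂ ◂ x₃ ◂ x₄ ◂ x₅ ◂ a

input pointer power top scratch₁ scratch₂ : Location
input    = direct 0
pointer  = direct 1
power    = direct 2
top      = direct 3
scratch₁ = direct 4
scratch₂ = direct 5

program : ASRAM
program =
    ram (assign pointer (const 6))
  ∷ ram (assign (direct 6) (const 2))
    -- 2: one large number per bit of the input
  ∷ ram (jumpEq (load input) (const 0) 7)
  ∷ ram (apply div input (load input) (const 2))
  ∷ ram (apply add pointer (const 1) (load pointer))
  ∷ callALN (indirect 1)
  ∷ ram (jumpEq (const 0) (const 0) 2)
    -- 7: square the last large number
  ∷ ram (apply mul power (load (indirect 1)) (load (indirect 1)))
    -- 8: from P = aₖᴱ to aₖ₋₁ᴱᴱ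
  ∷ ram (jumpEq (load pointer) (const 6) 20)
  ∷ ram (assign top (load (indirect 1)))
  ∷ ram (apply monus pointer (load pointer) (const 1))
  -- These four instructions leave P mod (aₖ - aₖ₋₁) in `scratch₂`, which is aₖ₋₁^E when the array
  -- grows fast enough.
  ∷ ram (apply monus scratch₁ (load top) (load (indirect 1)))
  ∷ ram (apply div scratch₂ (load power) (load scratch₁))
  ∷ ram (apply mul scratch₂ (load scratch₂) (load scratch₁))
  ∷ ram (apply monus scratch₂ (load power) (load scratch₂))
  -- The same remainder modulo aₖ - aₖ₋₁^E yields (aₖ₋₁^E)^E as the new P.
  ∷ ram (apply monus scratch₁ (load top) (load scratch₂))
  ∷ ram (apply div scratch₂ (load power) (load scratch₁))
  ∷ ram (apply mul scratch₂ (load scratch₂) (load scratch₁))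
  ∷ ram (apply monus power (load power) (load scratch₂))
  ∷ ram (jumpEq (const 0) (const 0) 8)
    -- 20: output P
  ∷ ram (assign input (load power))
  ∷ []

-- Execution of the program on arbitrary sequences

-- The form copies the instructions. It also covers divisor 0, which can occur when the ALN values
-- are arbitrary.
_rem_ : ℕ → ℕ → ℕ
m rem n = m ∸ (m ÷ n) * n

-- The effect of the second loop on P, for any array whatsoever.
descend : (ℕ → ℕ) → ℕ → ℕ → ℕ
descend a zero    P = P
descend a (suc k) P = descend a k (P rem (a (suc k) ∸ P rem (a (suc k) ∸ a k)))

descend-cong : ∀ {a a′} k → (∀ j → j ≤ k → a j ≡ a′ j) → ∀ P → descend a k P ≡ descend a′ k P
descend-cong zero    a≡a′ P = refl
descend-cong (suc k) a≡a′ P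
  rewrite a≡a′ (suc k) ≤-refl | a≡a′ k (n≤1+n k) = descend-cong k (λ j j≤k → a≡a′ j (m≤n⇒m≤1+n j≤k)) _

_≈_ : ASState → ASState → Set
(σ , i) ≈ (σ′ , i′) = pc σ ≡ pc σ′ × regs σ ≗ regs σ′ × i ≡ i′

asExec-cong : ∀ {A s s′} ins → s ≈ s′ → asExec A ins s ≈ asExec A ins s′
asExec-cong (ram (assign l a))    (refl , R≗R′ , refl) =
  refl , update-cong R≗R′ (address-cong l R≗R′) (value-cong a R≗R′) , refl
asExec-cong (ram (apply o l a b)) (refl , R≗R′ , refl) =
  refl , update-cong R≗R′ (address-cong l R≗R′)
           (cong₂ (arith o) (value-cong a R≗R′) (value-cong b R≗R′)) , refl
asExec-cong (ram (jumpEq a b t)) (refl , R≗R′ , refl)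
  rewrite value-cong a R≗R′ | value-cong b R≗R′ = refl , R≗R′ , refl
asExec-cong (callALN l) (refl , R≗R′ , refl) =
  refl , update-cong R≗R′ (address-cong l R≗R′) refl , refl

asStep-cong : ∀ {A r s s′} → s ≈ s′ → Pointwise _≈_ (asStep A r s) (asStep A r s′)
asStep-cong {A} {r} {s@(σ , i)} {s′@(⟨ _ , _ ⟩ , _)} s≈s′@(refl , _) with nth r (pc σ)
... | nothing  = nothing
... | just ins = just (asExec-cong {A} {s} {s′} ins s≈s′)

HaltsFrom : (ℕ → ℕ) → ASState → (time out : ℕ) → Set
HaltsFrom A s t v = ∃₂ λ σ i → asStep A program ⊢ s ⇓⟨ t ⟩ (σ , i) × output σ ≡ v

continue : ∀ {A s s′ t v} → asStep A program s ≡ just s′ → HaltsFrom A s′ t v → HaltsFrom A s (suc t) v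
continue eq (σ , i , run , out) = σ , i , next eq run , out

-- Executing instructions leaves a nest of register updates. This trades it for a pointwise equal
-- `memory`.
replace : ∀ {A pc i R R′ t v} →
          R 0 ≡ R′ 0 → R 1 ≡ R′ 1 → R 2 ≡ R′ 2 → R 3 ≡ R′ 3 → R 4 ≡ R′ 4 → R 5 ≡ R′ 5 →
          (∀ j → R (6 + j) ≡ R′ (6 + j)) →
          HaltsFrom A (⟨ pc , R ⟩ , i) t v → HaltsFrom A (⟨ pc , R′ ⟩ , i) t v
replace {A} {R = R} {R′} e₀ e₁ e₂ e₃ e₄ e₅ e (σ , i , run , out)
  with ⇓-simulate {_~_ = _≈_} (λ {s} {s′} → asStep-cong {A} {program} {s} {s′}) (refl , R≗R′ , refl) run
  where
  R≗R′ : R ≗ R′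
  R≗R′ 0 = e₀
  R≗R′ 1 = e₁
  R≗R′ 2 = e₂
  R≗R′ 3 = e₃
  R≗R′ 4 = e₄
  R≗R′ 5 = e₅
  R≗R′ (suc (suc (suc (suc (suc (suc j)))))) = e j
... | (σ′ , i′) , run′ , _ , σ≗σ′ , _ = σ′ , i′ , run′ , trans (sym (σ≗σ′ 0)) out

-- The loop body is cut into straight segments of 4, 3 and 5 steps, each executed symbolically and
-- then folded back into `memory` form.
subtract-previous : ∀ {A a i k P x₃ x₄ x₅ t v} →
  HaltsFrom A (⟨ 12 , memory 0 (6 + k) P (a (suc k)) (a (suc k) ∸ a k) x₅ a ⟩ , i) t v →
  HaltsFrom A (⟨ 8 , memory 0 (7 + k) P x₃ x₄ x₅ a ⟩ , i) (4 + t) v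
subtract-previous {a = a} {k = k} {P} {x₅ = x₅} rest =
  continue refl (continue refl (continue refl (continue refl
  (replace {R = memory 0 (6 + k) P (a (suc k)) (a (suc k) ∸ a k) x₅ a}
    refl refl refl refl refl refl (λ _ → refl) rest))))

first-remainder : ∀ {A a i x₁ P x₃ x₄ x₅ t v} →
  HaltsFrom A (⟨ 15 , memory 0 x₁ P x₃ x₄ (P rem x₄) a ⟩ , i) t v →
  HaltsFrom A (⟨ 12 , memory 0 x₁ P x₃ x₄ x₅ a ⟩ , i) (3 + t) v
first-remainder {a = a} {x₁ = x₁} {P} {x₃} {x₄} rest =
  continue refl (continue refl (continue refl
  (replace {R = memory 0 x₁ P x₃ x₄ (P rem x₄) a}
    refl refl refl refl refl refl (λ _ → refl) rest)))

second-remainder : ∀ {A a i x₁ P x₃ x₄ x₅ t v} → let y = x₃ ∸ x₅ in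
  HaltsFrom A (⟨ 8 , memory 0 x₁ (P rem y) x₃ y ((P ÷ y) * y) a ⟩ , i) t v →
  HaltsFrom A (⟨ 15 , memory 0 x₁ P x₃ x₄ x₅ a ⟩ , i) (5 + t) v
second-remainder {a = a} {x₁ = x₁} {P} {x₃} {x₅ = x₅} rest =
  continue refl (continue refl (continue refl (continue refl (continue refl
  (replace {R = let y = x₃ ∸ x₅ in memory 0 x₁ (P rem y) x₃ y ((P ÷ y) * y) a}
    refl refl refl refl refl refl (λ _ → refl) rest)))))

descend-halts : ∀ {A a i} k P {x₃ x₄ x₅} →
  HaltsFrom A (⟨ 8 , memory 0 (6 + k) P x₃ x₄ x₅ a ⟩ , i) (k * 12 + 2) (descend a k P)
-- The pointer is back at a₀. Two steps remain: the jump to 20 and the copy to the output.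
descend-halts         zero    P = _ , _ , next refl (next refl (stop refl)) , refl
descend-halts {a = a} (suc k) P =
  subtract-previous (first-remainder (second-remainder (descend-halts {a = a} k _)))

n/2≡⌊n/2⌋ : ∀ n → n / 2 ≡ ⌊ n /2⌋
n/2≡⌊n/2⌋ zero          = refl
n/2≡⌊n/2⌋ (suc zero)    = refl
n/2≡⌊n/2⌋ (suc (suc n)) =
  trans (m/n≡1+[m∸n]/n {suc (suc n)} {2} (s≤s (s≤s z≤n))) (cong suc (n/2≡⌊n/2⌋ n))

bitLength-/2 : ∀ n → bitLength (n / 2) ≡ bitLength n ∸ 1
bitLength-/2 n = trans (cong bitLength (n/2≡⌊n/2⌋ n))
  (⌈log₂⌈n/2⌉⌉≡⌈log₂n⌉∸1 (suc n))

bitLength-suc>0 : ∀ n → 0 < bitLength (suc n)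
bitLength-suc>0 n = ⌈log₂⌉-mono-≤ {2} {suc (suc n)} (s≤s (s≤s z≤n))

Stored : (ℕ → ℕ) → ℕ → (ℕ → ℕ) → Set
Stored A i a = ∀ j → j ≤ i → a j ≡ (2 ◂ A) j

store : ∀ {A i a} → Stored A i a → Stored A (suc i) (a [ suc i ≔ A i ])
store {A} {i} stored j j≤1+i with j ≡ᵇ suc i | ≡ᵇ⇒≡ j (suc i) | ≡⇒≡ᵇ j (suc i)
... | true  | eq | _  = cong (2 ◂ A) (sym (eq tt))
... | false | _  | neq with m≤n⇒m<n∨m≡n j≤1+i
...   | inj₁ j<1+i = stored j (s≤s⁻¹ j<1+i)
...   | inj₂ refl  = contradiction refl neq

-- Halving removes one bit per round, so there is one call per bit of the input. A round takes five
-- steps and the exit jump one more.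
gather-halts : ∀ {A k t v} m n i a → bitLength n ≡ m → i + m ≡ k → Stored A i a →
  (∀ a′ → Stored A k a′ → HaltsFrom A (⟨ 7 , memory 0 (6 + k) 0 0 0 0 a′ ⟩ , k) t v) →
  HaltsFrom A (⟨ 2 , memory n (6 + i) 0 0 0 0 a ⟩ , i) (m * 5 + suc t) v
gather-halts zero zero i a _ i≡k stored exit
  rewrite trans (sym (+-identityʳ i)) i≡k = continue refl (exit a stored)
gather-halts zero (suc n) i a len _ _ _ = contradiction len (>⇒≢ (bitLength-suc>0 n))
gather-halts (suc m) zero i a () _ _ _
gather-halts {A} (suc m) (suc n) i a len i+m≡k stored exit =
  continue refl (continue refl (continue refl (continue refl (continue refl
  (replace refl refl refl refl refl refl (λ _ → refl)
    (gather-halts m (suc n / 2) (suc i) (a [ suc i ≔ A i ])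
      (trans (bitLength-/2 (suc n)) (cong (_∸ 1) len)) (trans (sym (+-suc i m)) i+m≡k)
      (store {A} {i} {a} stored) exit))))))

result : (ℕ → ℕ) → ℕ → ℕ
result A m = descend (2 ◂ A) m ((2 ◂ A) m * (2 ◂ A) m)

-- No growth condition on `A` enters, so the same run gives both the worst-case time and, for
-- suitable `A`, the computed value.
program-halts : ∀ A inp →
  let m = bitLength inp in ASRAMHalts A program inp (6 + m * 17) (result A m)
program-halts A inp = subst (λ t → ASRAMHalts A program inp t (result A m)) (time m)
  (continue refl (continue refl
  (replace {R = memory inp 6 0 0 0 0 (2 ◂ λ _ → 0)} refl refl refl refl refl refl zeros
    (gather-halts m inp 0 (2 ◂ λ _ → 0) refl refl (λ { zero _ → refl }) finish))))
  where
  m = bitLength inp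
  zeros : ∀ j → (2 ◂ λ _ → 0) j ≡ ((initial (inp ∷ []) [ 1 ≔ 6 ]) [ 6 ≔ 2 ]) (6 + j)
  zeros zero    = refl
  zeros (suc j) = refl
  time : ∀ m → 2 + (m * 5 + suc (suc (m * 12 + 2))) ≡ 6 + m * 17
  time = ℕ-Ring.solve-∀
  finish : ∀ a → Stored A m a → HaltsFrom A (⟨ 7 , memory 0 (6 + m) 0 0 0 0 a ⟩ , m)
             (suc (m * 12 + 2)) (result A m)
  finish a stored
    rewrite sym (descend-cong m stored ((2 ◂ A) m * (2 ◂ A) m)) | sym (stored m ≤-refl) =
    continue refl (replace refl refl refl refl refl refl (λ _ → refl) (descend-halts {a = a} m (a m * a m)))

-- Rapidly growing sequences form an ALS set

Sparse : (ℕ → ℕ) → ℕ → (ℕ → ℕ) → Set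
Sparse G c A = ∀ i → G ((c ◂ A) i) < A i

module _ (G : ℕ → ℕ) where

  fastGrowing : ℕ → ℕ → ℕ
  fastGrowing a zero    = a
  fastGrowing a (suc i) = suc (G (fastGrowing a i))

  fastGrowing-sparse : ∀ {c a} → G c < a → Sparse G c (fastGrowing a)
  fastGrowing-sparse large zero    = large
  fastGrowing-sparse large (suc i) = ≤-refl

  -- After incrementing term `i` the old later terms may be too small, so they are rebuilt by
  -- `fastGrowing`; an ALS set asks for agreement only before `i`. The recursion peels off the head,
  -- which becomes the next starting value `c`.
  sparse-increment : ∀ i {c} A → Sparse G c A →
    ∃ λ B → Sparse G c B × B i ≡ suc (A i) × (∀ j → j < i → B j ≡ A j)
  sparse-increment zero A sparse =
    fastGrowing (suc (A 0)) , fastGrowing-sparse (m≤n⇒m≤1+n (sparse 0)) , refl , λ _ ()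
  sparse-increment (suc i) A sparse
    with sparse-increment i {A 0} (A ∘ suc) (λ { zero → sparse 1 ; (suc j) → sparse (2 + j) })
  ... | B , sparseB , B≡ , kept =
    A 0 ◂ B , (λ { zero → sparse 0 ; (suc zero) → sparseB 0 ; (suc (suc j)) → sparseB (suc j) }) , B≡ ,
    λ { zero _ → refl ; (suc j) (s≤s j<i) → kept j j<i }

  sparse-ALS : ∀ c → IsALS (Sparse G c)
  sparse-ALS c .IsALS.nonempty  = fastGrowing (suc (G c)) , fastGrowing-sparse ≤-refl
  sparse-ALS c .IsALS.increment i A = sparse-increment i A

-- Raising to a power by taking remainders

power-expand : ∀ x d E → ∃ λ q → (x + d) ^ E ≡ x ^ E + q * d
power-expand x d zero    = 0 , refl
power-expand x d (suc E) with power-expand x d E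
... | q , eq = x * q + x ^ E + d * q , trans (cong ((x + d) *_) eq) (regroup x d (x ^ E) q)
  where
  regroup : ∀ x d p q → (x + d) * (p + q * d) ≡ x * p + (x * q + p + d * q) * d
  regroup = ℕ-Ring.solve-∀

rem≡% : ∀ m n .{{_ : NonZero n}} → m rem n ≡ m % n
rem≡% m n@(suc _) = sym (m%n≡m∸m/n*n m n)

-- Modulo d = a - x one has a ≡ x, hence a^E ≡ x^E. The hypothesis says x^E < d, so x^E is the
-- remainder itself.
power-rem : ∀ {a x} E → x + x ^ E < a → (a ^ E) rem (a ∸ x) ≡ x ^ E
power-rem {a} {x} E large with a ∸ x in d≡ | m+[n∸m]≡n {x} {a} (≤-trans (m≤m+n x (x ^ E)) (<⇒≤ large))
... | d | refl = begin
  ((x + d) ^ E) rem d       ≡⟨ cong (_rem d) (proj₂ (power-expand x d E)) ⟩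
  (x ^ E + q * d) rem d     ≡⟨ rem≡% _ d ⟩
  (x ^ E + q * d) % d       ≡⟨ [m+kn]%n≡m%n (x ^ E) q d ⟩
  x ^ E % d                 ≡⟨ m<n⇒m%n≡m small ⟩
  x ^ E                     ∎
  where
  open ≡-Reasoning
  q = proj₁ (power-expand x d E)
  small : x ^ E < d
  small = +-cancelˡ-< x (x ^ E) d large
  instance
    d≢0 : NonZero d
    d≢0 = >-nonZero (≤-<-trans z≤n small)

n≤n^m : ∀ n m .{{_ : NonZero m}} → n ≤ n ^ m
n≤n^m zero      (suc m) = z≤n
n≤n^m n@(suc _) (suc m) = m≤m*n n (n ^ m) {{m^n≢0 n m}}

module _ {F A} (sparse : Sparse (λ x → x ^ F + x ^ F) 2 A) where

  sparse-nonZero : ∀ k → NonZero ((2 ◂ A) k)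
  sparse-nonZero zero    = _
  sparse-nonZero (suc k) = >-nonZero (≤-<-trans z≤n (sparse k))

  -- The exponent is squared at each level and ends as E^(2^k). All intermediate exponents are thus
  -- at most `F`, and a single growth condition provides room for every remainder.
  descend-power : ∀ k E .{{_ : NonZero E}} → E ^ (2 ^ k) ≤ F →
                  descend (2 ◂ A) k ((2 ◂ A) k ^ E) ≡ 2 ^ (E ^ (2 ^ k))
  descend-power zero    E E≤F = cong (2 ^_) (sym (*-identityʳ E))
  descend-power (suc k) E E≤F = begin
    descend (2 ◂ A) k ((a ^ E) rem (a ∸ (a ^ E) rem (a ∸ x)))
      ≡⟨ cong (λ y → descend (2 ◂ A) k ((a ^ E) rem (a ∸ y))) (power-rem E (room 1≤F E≤)) ⟩
    descend (2 ◂ A) k ((a ^ E) rem (a ∸ x ^ E))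
      -- Here x^E takes the place of x, which raises to the power E a second time.
      ≡⟨ cong (descend (2 ◂ A) k) (power-rem E (subst (λ y → x ^ E + y < a) (sym (^-*-assoc x E E)) (room′ E≤ EE≤))) ⟩
    descend (2 ◂ A) k ((x ^ E) ^ E)
      ≡⟨ cong (descend (2 ◂ A) k) (^-*-assoc x E E) ⟩
    descend (2 ◂ A) k (x ^ (E * E))
      ≡⟨ descend-power k (E * E) {{m*n≢0 E E}} (≤-trans (≤-reflexive square) E≤F) ⟩
    2 ^ ((E * E) ^ (2 ^ k))
      ≡⟨ cong (2 ^_) square ⟩
    2 ^ (E ^ (2 ^ suc k)) ∎
    where
    open ≡-Reasoning
    x = (2 ◂ A) k
    a = A k
    instance
      x≢0 : NonZero x
      x≢0 = sparse-nonZero k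
    square : (E * E) ^ (2 ^ k) ≡ E ^ (2 ^ suc k)
    square = trans (cong (λ y → (E * y) ^ (2 ^ k)) (sym (*-identityʳ E))) (^-*-assoc E 2 (2 ^ k))
    EE≤ : E * E ≤ F
    EE≤ = ≤-trans (n≤n^m (E * E) (2 ^ k) {{m^n≢0 2 k}}) (≤-trans (≤-reflexive square) E≤F)
    E≤ : E ≤ F
    E≤ = ≤-trans (m≤m*n E E) EE≤
    1≤F : 1 ≤ F
    1≤F = ≤-trans (n≢0⇒n>0 (≢-nonZero⁻¹ E)) E≤
    room′ : ∀ {e e′} → e ≤ F → e′ ≤ F → x ^ e + x ^ e′ < a
    room′ e≤F e′≤F = ≤-<-trans (+-mono-≤ (^-monoʳ-≤ x e≤F) (^-monoʳ-≤ x e′≤F)) (sparse k)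
    room : ∀ {e′} → 1 ≤ F → e′ ≤ F → x + x ^ e′ < a
    room {e′} 1≤F e′≤F = subst (λ y → y + x ^ e′ < a) (*-identityʳ x) (room′ 1≤F e′≤F)

tripleExp : ℕ → ℕ
tripleExp n = 2 ^ (2 ^ (2 ^ bitLength n))

tripleExp∈ASRAM : tripleExp ∈ PolyTimeASRAM
tripleExp∈ASRAM = program , computes , 6 ∷ 17 ∷ [] , time
  where
  computes : ASRAMComputes program tripleExp
  computes inp = Sparse G 2 , sparse-ALS G 2 , λ A sparse →
    6 + m * 17 , subst (ASRAMHalts A program inp (6 + m * 17)) (value≡ A sparse) (program-halts A inp)
    where
    m = bitLength inp
    -- The final exponent when the descent starts from the square of the last large number, that is,
    -- from E = 2, and passes through `m` levels.
    F = 2 ^ (2 ^ m)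
    G : ℕ → ℕ
    G x = x ^ F + x ^ F
    value≡ : ∀ A → Sparse G 2 A → result A m ≡ tripleExp inp
    value≡ A sparse =
      trans (cong (λ y → descend (2 ◂ A) m ((2 ◂ A) m * y)) (sym (*-identityʳ ((2 ◂ A) m))))
            (descend-power sparse m 2 ≤-refl)
  time : ∀ inp → ASRAMTime≤ program inp (eval (6 ∷ 17 ∷ []) (bitLength inp))
  time inp A = 6 + m * 17 , _ , program-halts A inp ,
    ≤-reflexive (cong (λ x → 6 + m * (17 + x)) (sym (*-zeroʳ m)))
    where m = bitLength inp

-- The triple exponential outgrows every polynomial-time ARAM

m+n≤2^m*n : ∀ m {n} → 1 ≤ n → m + n ≤ 2 ^ m * n
m+n≤2^m*n m {n@(suc _)} 1≤n = begin
  m + n       ≤⟨ +-monoˡ-≤ n (m≤m*n m n) ⟩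
  m * n + n   ≡⟨ +-comm (m * n) n ⟩
  suc m * n   ≤⟨ *-monoˡ-≤ n (n<2^n m) ⟩
  2 ^ m * n   ∎
  where open ≤-Reasoning

-- At a power of two the polynomial is bounded by one power of two with exponent linear in `j`. The
-- sum of the coefficients absorbs all of them, and the length stands in for the degree.
eval-2^≤ : ∀ p j → eval p (2 ^ j) ≤ 2 ^ (sum p + length p * j)
eval-2^≤ []       j = z≤n
eval-2^≤ (c ∷ cs) j = begin
  c + 2 ^ j * eval cs (2 ^ j)                      ≤⟨ +-monoʳ-≤ c (*-monoʳ-≤ (2 ^ j) (eval-2^≤ cs j)) ⟩
  c + 2 ^ j * 2 ^ (sum cs + length cs * j)         ≡⟨ cong (c +_) (^-distribˡ-+-* 2 j _) ⟨
  c + 2 ^ (j + (sum cs + length cs * j))           ≤⟨ m+n≤2^m*n c (m^n>0 2 (j + (sum cs + length cs * j))) ⟩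
  2 ^ c * 2 ^ (j + (sum cs + length cs * j))       ≡⟨ ^-distribˡ-+-* 2 c _ ⟨
  2 ^ (c + (j + (sum cs + length cs * j)))         ≡⟨ cong (2 ^_) (regroup c j (sum cs) (length cs)) ⟩
  2 ^ (c + sum cs + (j + length cs * j))           ∎
  where
  open ≤-Reasoning
  regroup : ∀ c j s l → c + (j + (s + l * j)) ≡ c + s + (j + l * j)
  regroup = ℕ-Ring.solve-∀

linear≤2^ : ∀ α β → ∃ λ j → α + β * j ≤ 2 ^ j
linear≤2^ α β = j , (begin
  α + β * j               ≤⟨ +-mono-≤ (m≤m+n α β) (*-monoˡ-≤ j (m≤n+m β α)) ⟩
  c + c * j               ≡⟨ *-suc c j ⟨
  c * suc j               ≤⟨ *-mono-≤ (<⇒≤ (n<2^n c)) 1+j≤ ⟩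
  2 ^ c * 2 ^ (2 + c)     ≡⟨ ^-distribˡ-+-* 2 c (2 + c) ⟨
  2 ^ j                   ∎)
  where
  open ≤-Reasoning
  c = α + β
  -- Chosen so that 2^j splits into 2^c, which is at least c, and 2^(2 + c), which is at least
  -- `suc j`.
  j = c + (2 + c)
  regroup : ∀ c → suc (c + (2 + c)) + suc (2 * c) ≡ 2 * (2 * suc c)
  regroup = ℕ-Ring.solve-∀
  1+j≤ : suc j ≤ 2 ^ (2 + c)
  1+j≤ = begin
    suc j                  ≤⟨ m≤m+n (suc j) (suc (2 * c)) ⟩
    suc j + suc (2 * c)    ≡⟨ regroup c ⟩
    2 * (2 * suc c)        ≤⟨ *-monoʳ-≤ 2 (*-monoʳ-≤ 2 (n<2^n c)) ⟩
    2 ^ (2 + c)            ∎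

sum≤2^ : ∀ c d j u {x y} → x ≤ 2 ^ u → y ≤ 2 ^ (d + u) →
         c + 2 ^ j + x * y ≤ 2 ^ (c + suc (j + (u + (d + u))))
sum≤2^ c d j u {x} {y} x≤ y≤ = begin
  c + 2 ^ j + x * y                    ≤⟨ +-monoʳ-≤ (c + 2 ^ j) (*-mono-≤ x≤ y≤) ⟩
  c + 2 ^ j + 2 ^ u * 2 ^ (d + u)      ≡⟨ cong (c + 2 ^ j +_) (^-distribˡ-+-* 2 u (d + u)) ⟨
  c + 2 ^ j + 2 ^ w                    ≡⟨ +-assoc c (2 ^ j) (2 ^ w) ⟩
  c + (2 ^ j + 2 ^ w)                  ≤⟨ +-monoʳ-≤ c (+-mono-≤ (^-monoʳ-≤ 2 (m≤m+n j w)) (^-monoʳ-≤ 2 (m≤n+m w j))) ⟩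
  c + (2 ^ (j + w) + 2 ^ (j + w))      ≡⟨ cong (λ z → c + (2 ^ (j + w) + z)) (+-identityʳ (2 ^ (j + w))) ⟨
  c + 2 ^ suc (j + w)                  ≤⟨ m+n≤2^m*n c (m^n>0 2 (suc (j + w))) ⟩
  2 ^ c * 2 ^ suc (j + w)              ≡⟨ ^-distribˡ-+-* 2 c (suc (j + w)) ⟨
  2 ^ (c + suc (j + w))                ∎
  where
  open ≤-Reasoning
  w = u + (d + u)

c+n≤2^[c+u] : ∀ c u {n} → n ≤ 2 ^ u → c + n ≤ 2 ^ (c + u)
c+n≤2^[c+u] c u n≤ = ≤-trans (+-monoʳ-≤ c n≤)
  (≤-trans (m+n≤2^m*n c (m^n>0 2 u)) (≤-reflexive (sym (^-distribˡ-+-* 2 c u))))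

-- With L = 2^j the left side is at most a power of two whose exponent is linear in j, and for a
-- suitable j this exponent is at most 2^j = L.
polynomial≤2^ : ∀ C p → ∃ λ L → let b = eval p L in 4 + C + L + b * (1 + (b + 3)) ≤ 2 ^ L
polynomial≤2^ C p = Product.map (2 ^_) (λ {j} → at j) (linear≤2^ (9 + C + 2 * sum p) (1 + 2 * length p))
  where
  regroup : ∀ C j s k → 4 + C + suc (j + (s + k * j + (4 + (s + k * j)))) ≡
            9 + C + 2 * s + (1 + 2 * k) * j
  regroup = ℕ-Ring.solve-∀
  at : ∀ j → 9 + C + 2 * sum p + (1 + 2 * length p) * j ≤ 2 ^ j →
       let b = eval p (2 ^ j) in 4 + C + 2 ^ j + b * (1 + (b + 3)) ≤ 2 ^ (2 ^ j)
  at j linear =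
    ≤-trans (sum≤2^ (4 + C) 4 j u b≤ (≤-trans (≤-reflexive (cong suc (+-comm b 3))) (c+n≤2^[c+u] 4 u b≤)))
            (^-monoʳ-≤ 2 {4 + C + suc (j + (u + (4 + u)))} {2 ^ j}
              (≤-trans (≤-reflexive (regroup C j (sum p) (length p))) linear))
    where
    b = eval p (2 ^ j)
    u = sum p + length p * j
    b≤ : b ≤ 2 ^ u
    b≤ = eval-2^≤ p j

-- On inputs of length L an ARAM outputs at most 2^(K 2^e) with K and e polynomial in L. Since K 2^e
-- < 2^(K + e), it suffices to find an L with K + e ≤ 2^L.
tripleExp∉ARAM : tripleExp ∉ PolyTimeARAM
tripleExp∉ARAM (r , computes , p , time) = uncurry exceeded (polynomial≤2^ (programSize r) p)
  where
  C = programSize r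
  exceeded : ∀ L → let b = eval p L in ¬ (4 + C + L + b * (1 + (b + 3)) ≤ 2 ^ L)
  exceeded L small = <-irrefl refl (begin-strict
    tripleExp inp                   ≤⟨ ARAM-output-bound {b = b} computes
                                 (subst (λ l → ARAMTime≤ r inp (eval p l)) inp-length (time inp)) ⟩
    (4 + C + inp) ^ (2 ^ e) ≤⟨ ^-monoˡ-≤ (2 ^ e) base≤ ⟩
    (2 ^ K) ^ (2 ^ e)       ≡⟨ ^-*-assoc 2 K (2 ^ e) ⟩
    2 ^ (K * 2 ^ e)         <⟨ ^-monoʳ-< 2 ≤-refl exponent< ⟩
    2 ^ (2 ^ (2 ^ L))       ≡⟨ cong (λ l → 2 ^ (2 ^ (2 ^ l))) inp-length ⟨
    tripleExp inp                   ∎)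
    where
    open ≤-Reasoning
    K = 4 + C + L
    b = eval p L
    e = b * (1 + (b + 3))
    -- The largest input of bit length `L`; its successor is exactly 2^L, so the rounded logarithm
    -- is exact.
    inp = pred (2 ^ L)
    inp-length : bitLength inp ≡ L
    inp-length = trans (cong ⌈log₂_⌉ (suc-pred (2 ^ L) {{m^n≢0 2 L}})) (⌈log₂2^n⌉≡n L)
    base≤ : 4 + C + inp ≤ 2 ^ K
    base≤ = c+n≤2^[c+u] (4 + C) L pred[n]≤n
    exponent< : K * 2 ^ e < 2 ^ (2 ^ L)
    exponent< = begin-strict
      K * 2 ^ e       <⟨ *-monoˡ-< (2 ^ e) {{m^n≢0 2 e}} (n<2^n K) ⟩
      2 ^ K * 2 ^ e   ≡⟨ ^-distribˡ-+-* 2 K e ⟨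
      2 ^ (K + e)     ≤⟨ ^-monoʳ-≤ 2 small ⟩
      2 ^ (2 ^ L)     ∎

theorem1 : (PolyTimeARAM[+,∸,×,÷] ⊆ PolyTimeASRAM[+,∸,×,÷]) ×
    (∃ λ f → f ∈ PolyTimeASRAM[+,∸,×,÷] × f ∉ PolyTimeARAM[+,∸,×,÷])
theorem1 = ARAM⊆ASRAM , tripleExp , tripleExp∈ASRAM , tripleExp∉ARAM
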